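{- $\mathrm{MHL}(\Diamond,\Box,@)$ has the quasi-quadratic size model property with respect to the frame class lin of all linear frames and with respect to the frame class $\{(\mathbb{N},<)\}$.
   Context: Syntax. Let NOM be a countable set of nominals. $\mathrm{MHL}(\Diamond,\Box,@)$ is the set of formulae $$\varphi ::= i \mid \top \mid \bot \mid \varphi\wedge\varphi \mid \varphi\vee\varphi \mid \Diamond\varphi\mid \Box\varphi \mid @_i\varphi \qquad (i\in \mathrm{NOM}),$$ with no negation and no atomic propositions. The modal depth $\mathrm{md}(\varphi)$ is the maximal nesting depth of the modal operators $\Diamond,\Box$ in $\varphi$. Semantics. A linear frame is a pair $(W,<)$ with $W\ne\emptyset$ and $<$ transitive, irreflexive and trichotomous. A model over $(W,<)$ is $K=(W,<,\eta)$ with $\eta:\mathrm{NOM}\to W$. Satisfaction: $K,w\models i$ iff $\eta(i)=w$; $\top,\bot,\wedge,\vee$ as usual; $K,w\models\Diamond\varphi$ iff $K,w'\models\varphi$ for some $w'>w$; $K,w\models\Box\varphi$ iff $K,w'\models\varphi$ for all $w'>w$; $K,w\models @_i\varphi$ iff $K,\eta(i)\models\varphi$. A model satisfies $\varphi$ if $\varphi$ holds at some state of it. A formula is satisfiable over a frame class $\mathfrak F$ if some model over a frame in $\mathfrak F$ satisfies it. Quasi-quadratic size. The states in the range of $\eta$ are called nominal states. Let $(0,1)_{\mathbb Q}$ be the open interval of rationals between $0$ and $1$ with its usual order. A model is of size quasi-quadratic in an integer $m$ if every interval between two consecutive nominal states (the set of states strictly between them) consists of at most $m$ states, possibly with one preceding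 isomorphic copy of $(0,1)_{\mathbb Q}$. A fragment has the quasi-quadratic size model property with respect to $\mathfrak F$ if for every formula $\varphi$ of the fragment that is satisfiable over $\mathfrak F$ there exists a model over a frame in $\mathfrak F$ that is of size quasi-quadratic in $\mathrm{md}(\varphi)$ and satisfies $\varphi$. -}

module Defs where

open import Level using (Level; 0ℓ; suc)
open import Data.Empty using (⊥)
open import Data.Fin using (Fin)
import Data.Fin as Fin
open import Data.Nat using (ℕ; _≤_; _⊔_)
import Data.Nat as ℕ
import Data.Nat.Properties as ℕₚ
open import Data.Product using (∃; ∃-syntax; _×_; proj₁)
open import Data.Rational using (ℚ; 0ℚ; 1ℚ)
import Data.Rational as ℚ
import Data.Rational.Properties as ℚₚ
open import Data.Sum using (_⊎_)
open import Data.Sum.Relation.Binary.LeftOrder using (_⊎-<_)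
open import Data.Sum.Relation.Binary.Pointwise using (Pointwise)
open import Data.Unit using (⊤)
open import Function using (_on_)
open import Relation.Binary.Core using (Rel)
open import Relation.Binary.Morphism.Structures using (IsOrderIsomorphism)
open import Relation.Binary.PropositionalEquality using (_≡_)
open import Relation.Binary.Structures using (IsStrictTotalOrder)
open import Relation.Nullary using (¬_)
open import Relation.Unary using (Pred; U; ｛_｝)

infix  30 ◇_ □_
infixr 25 _∧ᶠ_
infixr 24 _∨ᶠ_

data MHL (NOM : Set) : Set where
  nom   : NOM → MHL NOM
  ⊤ᶠ ⊥ᶠ : MHL NOM
  _∧ᶠ_  : MHL NOM → MHL NOM → MHL NOM
  _∨ᶠ_  : MHL NOM → MHL NOM → MHL NOM
  ◇_ □_ : MHL NOM → MHL NOM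
  at    : NOM → MHL NOM → MHL NOM

md : {NOM : Set} → MHL NOM → ℕ
md (nom i)  = 0
md ⊤ᶠ       = 0
md ⊥ᶠ       = 0
md (φ ∧ᶠ ψ) = md φ ⊔ md ψ
md (φ ∨ᶠ ψ) = md φ ⊔ md ψ
md (◇ φ)    = ℕ.suc (md φ)
md (□ φ)    = ℕ.suc (md φ)
md (at i φ) = md φ

record LinearFrame : Set₁ where
  field
    W                  : Set
    _<_                : Rel W 0ℓ
    nonempty           : ¬ (¬ W)
    isStrictTotalOrder : IsStrictTotalOrder _≡_ _<_

ℕ-frame : LinearFrame
ℕ-frame = record
  { W = ℕ ; _<_ = ℕ._<_ ; nonempty = λ empty → empty 0
  ; isStrictTotalOrder = ℕₚ.<-isStrictTotalOrder }

ℚ-frame : LinearFrame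
ℚ-frame = record
  { W = ℚ ; _<_ = ℚ._<_ ; nonempty = λ empty → empty 0ℚ
  ; isStrictTotalOrder = ℚₚ.<-isStrictTotalOrder }

FrameClass : (ℓ : Level) → Set (suc 0ℓ Level.⊔ suc ℓ)
FrameClass ℓ = Pred LinearFrame ℓ

lin : FrameClass 0ℓ
lin = U

onlyℕ : FrameClass (suc 0ℓ)
onlyℕ = ｛ ℕ-frame ｝

record Model (NOM : Set) : Set₁ where
  field
    frame : LinearFrame
  open LinearFrame frame public
  field
    η : NOM → W

module _ {NOM : Set} where
  open Model

  infix 4 _∋_⊨_ _satisfies_

  _∋_⊨_ : (K : Model NOM) → W K → MHL NOM → Set
  K ∋ w ⊨ nom i    = η K i ≡ w
  K ∋ w ⊨ ⊤ᶠ       = ⊤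
  K ∋ w ⊨ ⊥ᶠ       = ⊥
  K ∋ w ⊨ (φ ∧ᶠ ψ) = (K ∋ w ⊨ φ) × (K ∋ w ⊨ ψ)
  K ∋ w ⊨ (φ ∨ᶠ ψ) = (K ∋ w ⊨ φ) ⊎ (K ∋ w ⊨ ψ)
  K ∋ w ⊨ (◇ φ)    = ∃[ w′ ] (_<_ K w w′ × (K ∋ w′ ⊨ φ))
  K ∋ w ⊨ (□ φ)    = ∀ w′ → _<_ K w w′ → K ∋ w′ ⊨ φ
  K ∋ w ⊨ at i φ   = K ∋ η K i ⊨ φ

  _satisfies_ : Model NOM → MHL NOM → Set
  K satisfies φ = ∃[ w ] (K ∋ w ⊨ φ)

  SatisfiableOver : ∀ {ℓ} → FrameClass ℓ → MHL NOM → Set (suc 0ℓ Level.⊔ ℓ)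
  SatisfiableOver 𝔉 φ = ∃[ K ] (𝔉 (frame K) × K satisfies φ)

-- The open interval (a , b).  Its elements carry proofs of the two bounds,
-- so equality and order are those of the underlying states.
module _ (F : LinearFrame) (a b : LinearFrame.W F) where
  open LinearFrame F

  Interval : Set
  Interval = ∃[ x ] (a < x × x < b)

  ≈ᴵ : Rel Interval 0ℓ
  ≈ᴵ = _≡_ on proj₁

  <ᴵ : Rel Interval 0ℓ
  <ᴵ = _<_ on proj₁

⟨0,1⟩ℚ : Set
⟨0,1⟩ℚ = Interval ℚ-frame 0ℚ 1ℚ

_≈₀₁_ _<₀₁_ : Rel ⟨0,1⟩ℚ 0ℓ
_≈₀₁_ = ≈ᴵ ℚ-frame 0ℚ 1ℚ
_<₀₁_ = <ᴵ ℚ-frame 0ℚ 1ℚ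

module _ (F : LinearFrame) (a b : LinearFrame.W F) where

  -- A finite linear order with k elements is a copy of Fin k.
  ConsistsOf : ℕ → Set
  ConsistsOf k = ∃[ f ]
    IsOrderIsomorphism {A = Fin k} _≡_ (≈ᴵ F a b) Fin._<_ (<ᴵ F a b) f

  -- Order type of (0,1)_ℚ followed by k states: _⊎-<_ is the ordinal sum.
  ConsistsOfℚThen : ℕ → Set
  ConsistsOfℚThen k = ∃[ f ]
    IsOrderIsomorphism {A = ⟨0,1⟩ℚ ⊎ Fin k}
      (Pointwise _≈₀₁_ _≡_) (≈ᴵ F a b) (_<₀₁_ ⊎-< Fin._<_) (<ᴵ F a b) f

module _ {NOM : Set} (K : Model NOM) where
  open Model K

  Nominal : W → Set
  Nominal w = ∃[ i ] η i ≡ w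

  ConsecutiveNominals : W → W → Set
  ConsecutiveNominals a b =
    Nominal a × Nominal b × a < b × (∀ c → Nominal c → ¬ (a < c × c < b))

  QuasiQuadraticIn : ℕ → Set
  QuasiQuadraticIn m = ∀ a b → ConsecutiveNominals a b →
    ∃[ k ] (k ≤ m × (ConsistsOf frame a b k ⊎ ConsistsOfℚThen frame a b k))

QuasiQuadraticSizeModelProperty :
  ∀ {ℓ} → Set → FrameClass ℓ → Set (suc 0ℓ Level.⊔ ℓ)
QuasiQuadraticSizeModelProperty NOM 𝔉 =
  (φ : MHL NOM) → SatisfiableOver 𝔉 φ →
  ∃[ K ] (𝔉 (Model.frame K) × QuasiQuadraticIn K (md φ) × K satisfies φ)

{-# OPTIONS --safe #-}

-- Between consecutive nominal states nothing but nominals distinguishes states, so up to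
-- depth m a state is determined by its gap and the number, cut off at m, of states between
-- it and the next nominal.  A gap can therefore be replaced by its last m states or, if it
-- has only k < m states with finitely many gap states after them and others before, by a
-- dense block followed by k states.  In the first case a state with at least m gap states
-- after it is sent to the nominal state starting the gap: up to depth m the two see the same
-- and, formulas being positive, the nominals true only at the latter do no harm.  Which
-- replacement applies is not decidable, so only the double negation of the existence of a
-- suitable choice is proved; since the candidates are finitely many and satisfaction in each
-- is decidable, via the finite quotient collapsing every dense block to one reflexive state,
-- a search finds one.
module Submission where

open import Defs
open import Data.Bool using (Bool; true; false)
open import Data.Empty using (⊥; ⊥-elim)
open import Data.Fin using (Fin; zero; suc; toℕ; fromℕ<)
import Data.Fin as Fin
import Data.Fin.Properties as Finₚ
open import Data.List using (List; []; _∷_; _++_)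
open import Data.List.Membership.Propositional using (_∈_)
open import Data.List.Membership.Propositional.Properties using (∈-++⁺ˡ; ∈-++⁺ʳ)
open import Data.List.Relation.Unary.Any using (here; there)
open import Data.Nat using (ℕ; zero; suc; _+_; _≤_; z≤n; s≤s)
import Data.Nat as ℕ
import Data.Nat.Properties as ℕₚ
open import Data.Product using (Σ-syntax; ∃; ∃-syntax; _×_; _,_; proj₁; proj₂)
open import Data.Rational using (0ℚ; 1ℚ)
import Data.Rational as ℚ
import Data.Rational.Properties as ℚₚ
open import Data.Sum using (_⊎_; inj₁; inj₂)
open import Data.Sum.Properties using (inj₁-injective; inj₂-injective; ≡-dec)
open import Data.Sum.Relation.Binary.LeftOrder
  using (_⊎-<_; ₁∼₁; ₁∼₂; ₂∼₂; ⊎-<-decidable; drop-inj₂)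
open import Data.Sum.Relation.Binary.Pointwise using (Pointwise; inj₁; inj₂)
open import Data.Unit using (⊤; tt)
open import Data.Vec using (Vec; []; _∷_; lookup)
import Data.Vec.Functional as Vector
open import Function using (_∘_; id)
open import Function.Bundles using (_↣_)
open import Level using (0ℓ)
open import Relation.Binary.Core using (Rel)
open import Relation.Binary.Definitions
  using (tri<; tri≈; tri>; Decidable; DecidableEquality; Trichotomous; Transitive)
open import Relation.Binary.Morphism.Structures using (IsOrderIsomorphism)
open import Relation.Binary.PropositionalEquality
open import Relation.Binary.Structures using (IsStrictTotalOrder)
open import Relation.Nullary using (¬_; Dec; yes; no; contradiction)
open import Relation.Nullary.Decidable
  using (¬¬-excluded-middle; decidable-stable; map′; ¬?; _×-dec_; _⊎-dec_; _→-dec_; toWitness;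
         via-injection)
open import Relation.Nullary.Negation using (¬¬-map)
import Relation.Unary as Unary

-- The double-negation monad.

return : {A : Set} → A → ¬ ¬ A
return a ¬a = ¬a a

infixl 1 _>>=_
_>>=_ : {A B : Set} → ¬ ¬ A → (A → ¬ ¬ B) → ¬ ¬ B
(m >>= f) ¬b = m (λ a → f a ¬b)

-- Chains of points and gaps, and their finite quotients.

-- (q , k) describes a gap between consecutive points: a dense part, present iff
-- q is true, followed by k states.
Shape : Set
Shape = Bool × ℕ

-- `Admissible` receives the number of gaps still to come, so the last gap, which has no upper end,
-- is recognised by `0` and can be treated apart.
AllAdmissible : (ℕ → Shape → Set) → ∀ {n} → Vec Shape n → Set
AllAdmissible Admissible []                 = ⊤
AllAdmissible Admissible {suc n} (sh ∷ shs) = Admissible n sh × AllAdmissible Admissible shs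

-- The carrier D of the dense parts is a parameter: it will be (0,1)_ℚ or ℕ in the
-- constructed models, and a single reflexive state in the finite quotient.
BlockOf : Set → Bool → Set
BlockOf D true  = D
BlockOf D false = ⊥

GapOf : Set → Shape → Set
GapOf D (q , k) = BlockOf D q ⊎ Fin k

-- Each entry of `shs` contributes a point and then the gap after it. Nothing precedes the first
-- point, and the last gap is bounded by no point.
data ChainOf (D : Set) : ∀ {n} → Vec Shape n → Set where
  here  : ∀ {n sh} {shs : Vec Shape n} → ChainOf D (sh ∷ shs)
  gap   : ∀ {n sh} {shs : Vec Shape n} → GapOf D sh → ChainOf D (sh ∷ shs)
  later : ∀ {n sh} {shs : Vec Shape n} → ChainOf D shs → ChainOf D (sh ∷ shs)

module _ {D : Set} (_<ᴰ_ : Rel D 0ℓ) where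

  BlockOrder : ∀ q → Rel (BlockOf D q) 0ℓ
  BlockOrder true = _<ᴰ_
  BlockOrder false ()

  GapOrder : ∀ sh → Rel (GapOf D sh) 0ℓ
  GapOrder (q , k) = BlockOrder q ⊎-< Fin._<_

  data ChainOrder : ∀ {n} {shs : Vec Shape n} → Rel (ChainOf D shs) 0ℓ where
    here≺gap    : ∀ {n sh} {shs : Vec Shape n} {g} → ChainOrder {shs = sh ∷ shs} here (gap g)
    here≺later  : ∀ {n sh} {shs : Vec Shape n} {s} → ChainOrder {shs = sh ∷ shs} here (later s)
    gap≺gap     : ∀ {n sh} {shs : Vec Shape n} {g h} → GapOrder sh g h →
                  ChainOrder {shs = sh ∷ shs} (gap g) (gap h)
    gap≺later   : ∀ {n sh} {shs : Vec Shape n} {g s} →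
                  ChainOrder {shs = sh ∷ shs} (gap g) (later s)
    later≺later : ∀ {n sh} {shs : Vec Shape n} {s r} → ChainOrder {shs = shs} s r →
                  ChainOrder {shs = sh ∷ shs} (later s) (later r)

pointOf : ∀ {D n} (shs : Vec Shape n) → Fin n → ChainOf D shs
pointOf (sh ∷ shs) zero    = here
pointOf (sh ∷ shs) (suc j) = later (pointOf shs j)

module Chains (D : Set) (_<ᴰ_ : Rel D 0ℓ) where

  Block : Bool → Set
  Block = BlockOf D

  Gap : Shape → Set
  Gap = GapOf D

  Chain : ∀ {n} → Vec Shape n → Set
  Chain = ChainOf D

  Block< : ∀ q → Rel (Block q) 0ℓ
  Block< = BlockOrder _<ᴰ_

  Gap< : ∀ sh → Rel (Gap sh) 0ℓ
  Gap< = GapOrder _<ᴰ_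

  infix 4 _≺_

  _≺_ : ∀ {n} {shs : Vec Shape n} → Rel (Chain shs) 0ℓ
  _≺_ = ChainOrder _<ᴰ_

  pointAt : ∀ {n} (shs : Vec Shape n) → Fin n → Chain shs
  pointAt = pointOf

module Q = Chains ⊤ (λ _ _ → ⊤)

-- The one state of a quotient block sees itself. Stating this for every `q` spares later proofs a
-- case distinction.
Q-Block<-total : ∀ q d e → Q.Block< q d e
Q-Block<-total true d e = tt

-- The game between a linear frame and a quotient chain.

module Game (F : LinearFrame) (Nom : LinearFrame.W F → Set) where
  open LinearFrame F
  open IsStrictTotalOrder isStrictTotalOrder using (compare; _<?_; asym) 
    renaming (trans to <-trans; irrefl to <-irrefl)

  -- The head of `xs` is the upper end of the current gap, and the empty vector plays the role of
  -- infinity. The negation of `Below xs` thus describes the part of the frame that the rest of the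
  -- chain has to match.
  Below : ∀ {n} → Vec W n → W → Set
  Below []       w = ⊤
  Below (x ∷ xs) w = w < x

  Below? : ∀ {n} (xs : Vec W n) w → Dec (Below xs w)
  Below? []       w = yes tt
  Below? (x ∷ xs) w = w <? x

  ≮-<-trans : ∀ {u v w} → ¬ v < u → v < w → u < w
  ≮-<-trans {u} {v} ¬v<u v<w with compare u v
  ... | tri< u<v _ _ = <-trans u<v v<w
  ... | tri≈ _ refl _ = v<w
  ... | tri> _ _ v<u = contradiction v<u ¬v<u

  <-≮-trans : ∀ {u v w} → u < v → ¬ w < v → u < w
  <-≮-trans {u} {v} {w} u<v ¬w<v with compare v w
  ... | tri< v<w _ _ = <-trans u<v v<w
  ... | tri≈ _ refl _ = u<v
  ... | tri> _ _ w<v = contradiction w<v ¬w<v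

  Below-< : ∀ {n} (xs : Vec W n) {v w} → Below xs v → ¬ Below xs w → v < w
  Below-< []       v<x w≮x = contradiction tt w≮x
  Below-< (x ∷ xs) v<x w≮x = <-≮-trans v<x w≮x

  Asc : ∀ {n} → Vec W n → Set
  Asc []       = ⊤
  Asc (x ∷ xs) = Below xs x × Asc xs

  Asc-lookup : ∀ {n} {xs : Vec W n} → Asc xs → ∀ j → ¬ Below xs (lookup xs j)
  Asc-lookup {xs = x ∷ xs} (_ , asc) zero x<x = <-irrefl refl x<x
  Asc-lookup {xs = x ∷ xs} (x<xs , asc) (suc j) y<x =
    asym y<x (Below-< xs x<xs (Asc-lookup asc j))

  Asc-injective : ∀ {n} {xs : Vec W n} → Asc xs → ∀ i j → lookup xs i ≡ lookup xs j → i ≡ j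
  Asc-injective {xs = x ∷ xs} _ zero zero _ = refl
  Asc-injective {xs = x ∷ xs} (x<xs , asc) zero (suc j) eq =
    contradiction (subst (Below xs) eq x<xs) (Asc-lookup asc j)
  Asc-injective {xs = x ∷ xs} (x<xs , asc) (suc i) zero eq =
    contradiction (subst (Below xs) (sym eq) x<xs) (Asc-lookup asc i)
  Asc-injective {xs = x ∷ xs} (_ , asc) (suc i) (suc j) eq =
    cong suc (Asc-injective asc i j eq)

  Complete : ∀ {n} → Vec W n → Set
  Complete xs = ∀ y → Nom y → ¬ Below xs y → ∃[ j ] lookup xs j ≡ y

  Complete-tail : ∀ {n x} {xs : Vec W n} → Asc (x ∷ xs) → Complete (x ∷ xs) → Complete xs
  Complete-tail {x = x} {xs} (x<xs , _) complete y name y≮xs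
    with complete y name (asym (Below-< xs x<xs y≮xs))
  ... | zero  , refl = contradiction x<xs y≮xs
  ... | suc j , eq   = j , eq

  gap-anonymous : ∀ {n x} {xs : Vec W n} → Asc (x ∷ xs) → Complete (x ∷ xs) →
                  ∀ {y} → Nom y → x < y → ¬ Below xs y
  gap-anonymous (_ , asc) complete {y} name x<y y<xs with complete y name (asym x<y)
  ... | zero  , refl = <-irrefl refl x<y
  ... | suc j , refl = Asc-lookup asc j y<xs

  At : ∀ {n} {shs : Vec Shape n} → Vec W n → W → Q.Chain shs → Set
  At (x ∷ xs) w here      = w ≡ x
  At (x ∷ xs) w (gap g)   = ⊥
  At (x ∷ xs) w (later s) = At xs w s

  At⇒lookup : ∀ {n} {shs : Vec Shape n} (xs : Vec W n) {w} (s : Q.Chain shs) →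
              At xs w s → ∃[ j ] lookup xs j ≡ w × Q.pointAt shs j ≡ s
  At⇒lookup (x ∷ xs) here refl = zero , refl , refl
  At⇒lookup (x ∷ xs) (later s) at-s with At⇒lookup xs s at-s
  ... | j , eq , eq′ = suc j , eq , cong later eq′

  -- The n-round game.  Formulas are positive, so only the nominals true on the left
  -- have to be true on the right.
  Z : ∀ {n} {shs : Vec Shape n} → Vec W n → ℕ → W → Q.Chain shs → Set
  Z xs zero    w s = Nom w → At xs w s
  Z xs (suc l) w s = (Nom w → At xs w s)
    × (∀ v → w < v → ¬ ¬ (∃[ r ] (s Q.≺ r × Z xs l v r)))
    × (∀ r → s Q.≺ r → ¬ ¬ (∃[ v ] (w < v × Z xs l v r)))

  Z-nominal : ∀ {n} {shs : Vec Shape n} {xs : Vec W n} l {w} {s : Q.Chain shs} →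
              Z xs l w s → Nom w → At xs w s
  Z-nominal zero    z       = z
  Z-nominal (suc l) (z , _) = z

  Z-down : ∀ {n} {shs : Vec Shape n} {xs : Vec W n} {l l′} → l ≤ l′ →
           ∀ {w} {s : Q.Chain shs} → Z xs l′ w s → Z xs l w s
  Z-down {l′ = l′} z≤n z = Z-nominal l′ z
  Z-down (s≤s l≤l′) (name , forth , back) = name ,
    (λ v w<v → ¬¬-map (λ (r , s≺r , z) → r , s≺r , Z-down l≤l′ z) (forth v w<v)) ,
    (λ r s≺r → ¬¬-map (λ (v , w<v , z) → v , w<v , Z-down l≤l′ z) (back r s≺r))

  -- Moves only go upwards, so a play that starts in the tail never leaves it.
  Z-later : ∀ {n} {sh} {shs : Vec Shape n} {x} {xs : Vec W n} l {w} {s : Q.Chain shs} →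
            Z xs l w s → Z {shs = sh ∷ shs} (x ∷ xs) l w (later s)
  Z-later zero z = z
  Z-later {sh = sh} {shs} {x} {xs} (suc l) {w} {s} (name , forth , back) = name ,
    (λ v w<v → ¬¬-map (λ (r , s≺r , z) → later r , later≺later s≺r , Z-later l z) (forth v w<v)) ,
    back′
    where
    back′ : ∀ r → later {sh = sh} s Q.≺ r → ¬ ¬ (∃[ v ] (w < v × Z (x ∷ xs) l v r))
    back′ (later r) (later≺later s≺r) =
      ¬¬-map (λ (v , w<v , z) → v , w<v , Z-later l z) (back r s≺r)

  -- Matching a frame with a chain, gap by gap.

  module _ (m : ℕ) where

    -- `t` lists the last `k` states of the gap after `x`, and `Rest` is what precedes them there.
    -- The alternatives in `rest` are: nothing is left, the list was cut off at `m`, or what is left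
    -- is nonempty without a greatest element. The value of `q` is expressed by `Q.Block q` being
    -- inhabited or empty, which applies directly to the `d` of a state `gap (inj₁ d)`.
    record GapData {n} (x : W) (xs : Vec W n) (sh : Shape) : Set where
      q = proj₁ sh
      k = proj₂ sh
      field
        t : Fin k → W
      Rest : W → Set
      Rest v = x < v × Below xs v × (∀ i → v < t i)
      field
        t-above : ∀ i → x < t i
        t-below : ∀ i → Below xs (t i)
        t-mono  : ∀ {i j} → i Fin.< j → t i < t j
        cover   : ∀ v → x < v → Below xs v → (∃[ i ] v ≡ t i) ⊎ (∀ i → v < t i)
        rest    : (¬ Q.Block q × (∀ v → ¬ Rest v))
                ⊎ (¬ Q.Block q × k ≡ m)
                ⊎ (Q.Block q × ¬ ¬ (∃ Rest) × (∀ v → Rest v → ¬ ¬ (∃[ u ] (v < u × Rest u))))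

      t-reflects : ∀ i j → t i < t j → i Fin.< j
      t-reflects i j ti<tj with Finₚ.<-cmp i j
      ... | tri< i<j _ _ = i<j
      ... | tri≈ _ refl _ = contradiction ti<tj (<-irrefl refl)
      ... | tri> _ _ j<i = contradiction ti<tj (asym (t-mono j<i))

    -- `to` and `from` answer moves that leave the gap before the head of `xs`; `point` restarts the
    -- game with all `m` rounds after a jump by `at`.
    record Matched {n} (xs : Vec W n) (shs : Vec Shape n) : Set where
      field
        to    : ∀ w → ¬ Below xs w → ¬ ¬ (∃[ s ] Z {shs = shs} xs m w s)
        from  : ∀ s → ¬ ¬ (∃[ w ] (¬ Below xs w × Z {shs = shs} xs m w s))
        point : ∀ j → Z xs m (lookup xs j) (Q.pointAt shs j)

    -- The tail is matched for `m` rounds, hence by `Z-down` for any smaller number. Only positions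
    -- at `x` and inside the new gap need an analysis, by induction on the number of rounds.
    module Extend {n x sh} {xs : Vec W n} {shs : Vec Shape n}
                  (asc : Asc (x ∷ xs)) (complete : Complete (x ∷ xs))
                  (gd : GapData x xs sh) (matched : Matched xs shs) where
      open GapData gd
      open Matched matched

      Zˣ : ℕ → W → Q.Chain (sh ∷ shs) → Set
      Zˣ = Z (x ∷ xs)

      anonymous : ∀ {v} {A : Set} → x < v → Below xs v → Nom v → A
      anonymous x<v v<xs name = contradiction v<xs (gap-anonymous asc complete name x<v)

      to-later : ∀ {l} → l ≤ m → ∀ v → ¬ Below xs v → ¬ ¬ (∃[ s ] Zˣ l v (later s))
      to-later l≤m v v≮xs = ¬¬-map (λ (s , z) → s , Z-down l≤m (Z-later m z)) (to v v≮xs)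

      from-later : ∀ {l} → l ≤ m → ∀ {w} → Below xs w → ∀ s →
                   ¬ ¬ (∃[ v ] (w < v × Zˣ l v (later s)))
      from-later l≤m w<xs s =
        ¬¬-map (λ (v , v≮xs , z) → v , Below-< xs w<xs v≮xs , Z-down l≤m (Z-later m z)) (from s)

      -- By `cover`, the gap states above `t i` are exactly the `t j` with `i < j`, just as in the
      -- quotient.
      Z-t : ∀ l → l ≤ m → ∀ i → Zˣ l (t i) (gap (inj₂ i))
      Z-t zero    l≤m i = anonymous (t-above i) (t-below i)
      Z-t (suc l) l<m i = anonymous (t-above i) (t-below i) , forth , back
        where
        l≤m = ℕₚ.<⇒≤ l<m
        forth : ∀ v → t i < v → ¬ ¬ (∃[ r ] (gap (inj₂ i) Q.≺ r × Zˣ l v r))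
        forth v ti<v with Below? xs v
        ... | no v≮xs = to-later l≤m v v≮xs >>= λ (s , z) → return (later s , gap≺later , z)
        ... | yes v<xs with cover v (<-trans (t-above i) ti<v) v<xs
        ...   | inj₁ (j , refl) = return (gap (inj₂ j) , gap≺gap (₂∼₂ (t-reflects i j ti<v)) , Z-t l l≤m j)
        ...   | inj₂ v<t = contradiction ti<v (asym (v<t i))
        back : ∀ r → gap (inj₂ i) Q.≺ r → ¬ ¬ (∃[ v ] (t i < v × Zˣ l v r))
        back (gap (inj₂ j)) (gap≺gap (₂∼₂ i<j)) = return (t j , t-mono i<j , Z-t l l≤m j)
        back (later s) gap≺later = from-later l≤m (t-below i) s

      -- States skipped by the truncation: l rounds cannot exhaust the l states after t i, so
      -- the position of v relative to t i is not detected.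
      Z-before-t : ∀ l → l ≤ m → ∀ i → l + toℕ i ℕ.< k →
                   ∀ v → x < v → Below xs v → ¬ t i < v → Zˣ l v (gap (inj₂ i))
      Z-before-t zero    l≤m i _ v x<v v<xs ti≮v = anonymous x<v v<xs
      Z-before-t (suc l) l<m i room v x<v v<xs ti≮v = anonymous x<v v<xs , forth , back
        where
        l≤m = ℕₚ.<⇒≤ l<m
        si<k : suc (toℕ i) ℕ.< k
        si<k = ℕₚ.≤-<-trans (s≤s (ℕₚ.m≤n+m (toℕ i) l)) room
        i⁺ = fromℕ< si<k
        toℕ-i⁺ : toℕ i⁺ ≡ suc (toℕ i)
        toℕ-i⁺ = Finₚ.toℕ-fromℕ< si<k
        i<i⁺ : i Fin.< i⁺
        i<i⁺ = ℕₚ.≤-reflexive (sym toℕ-i⁺)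
        room⁺ : l + toℕ i⁺ ℕ.< k
        room⁺ = subst (ℕ._< k) (sym (trans (cong (l +_) toℕ-i⁺) (ℕₚ.+-suc l (toℕ i)))) room
        forth : ∀ u → v < u → ¬ ¬ (∃[ r ] (gap (inj₂ i) Q.≺ r × Zˣ l u r))
        forth u v<u with Below? xs u
        ... | no u≮xs = to-later l≤m u u≮xs >>= λ (s , z) → return (later s , gap≺later , z)
        ... | yes u<xs with t i⁺ <? u
        ...   | no t≮u = return (gap (inj₂ i⁺) , gap≺gap (₂∼₂ i<i⁺) ,
                                 Z-before-t l l≤m i⁺ room⁺ u (<-trans x<v v<u) u<xs t≮u)
        ...   | yes t<u with cover u (<-trans x<v v<u) u<xs
        ...     | inj₁ (j , refl) = return (gap (inj₂ j) ,
                    gap≺gap (₂∼₂ (Finₚ.<-trans i<i⁺ (t-reflects i⁺ j t<u))) , Z-t l l≤m j)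
        ...     | inj₂ u<t = contradiction t<u (asym (u<t i⁺))
        back : ∀ r → gap (inj₂ i) Q.≺ r → ¬ ¬ (∃[ u ] (v < u × Zˣ l u r))
        back (gap (inj₂ j)) (gap≺gap (₂∼₂ i<j)) =
          return (t j , ≮-<-trans ti≮v (t-mono i<j) , Z-t l l≤m j)
        back (later s) gap≺later = from-later l≤m v<xs s

      -- One reflexive state stands for all of `Rest`: a move within `Rest` is answered by staying
      -- there, and a move along the loop by a higher state of `Rest`, which exists because there is
      -- no greatest one.
      Z-dense : (∀ v → Rest v → ¬ ¬ (∃[ u ] (v < u × Rest u))) →
                ∀ l → l ≤ m → ∀ d v → Rest v → Zˣ l v (gap (inj₁ d))
      Z-dense unbounded zero    l≤m d v (x<v , v<xs , v<t) = anonymous x<v v<xs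
      Z-dense unbounded (suc l) l<m d v (x<v , v<xs , v<t) = anonymous x<v v<xs , forth , back
        where
        l≤m = ℕₚ.<⇒≤ l<m
        forth : ∀ u → v < u → ¬ ¬ (∃[ r ] (gap (inj₁ d) Q.≺ r × Zˣ l u r))
        forth u v<u with Below? xs u
        ... | no u≮xs = to-later l≤m u u≮xs >>= λ (s , z) → return (later s , gap≺later , z)
        ... | yes u<xs with cover u (<-trans x<v v<u) u<xs
        ...   | inj₁ (j , refl) = return (gap (inj₂ j) , gap≺gap ₁∼₂ , Z-t l l≤m j)
        ...   | inj₂ u<t = return (gap (inj₁ d) , gap≺gap (₁∼₁ (Q-Block<-total q d d)) ,
                                   Z-dense unbounded l l≤m d u (<-trans x<v v<u , u<xs , u<t))
        back : ∀ r → gap (inj₁ d) Q.≺ r → ¬ ¬ (∃[ u ] (v < u × Zˣ l u r))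
        back (gap (inj₁ e)) _ = unbounded v (x<v , v<xs , v<t) >>= λ (u , v<u , u-rest) →
          return (u , v<u , Z-dense unbounded l l≤m e u u-rest)
        back (gap (inj₂ j)) _ = return (t j , v<t j , Z-t l l≤m j)
        back (later s) gap≺later = from-later l≤m v<xs s

      -- Besides x itself, this applies to the states of a truncated gap that precede all t i.
      Z-here : ∀ l → l ≤ m → ∀ w → ¬ w < x → (Nom w → w ≡ x) → Below xs w → (∀ i → w < t i) →
               (Q.Block q → ¬ ¬ (∃[ v ] (w < v × Rest v))) → Zˣ l w here
      Z-here zero    l≤m w w≮x name w<xs w<t dense = name
      Z-here (suc l) l<m w w≮x name w<xs w<t dense = name , forth , back
        where
        l≤m = ℕₚ.<⇒≤ l<m
        forth : ∀ v → w < v → ¬ ¬ (∃[ r ] (here Q.≺ r × Zˣ l v r))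
        forth v w<v with Below? xs v
        ... | no v≮xs = to-later l≤m v v≮xs >>= λ (s , z) → return (later s , here≺later , z)
        ... | yes v<xs with cover v (≮-<-trans w≮x w<v) v<xs | rest
        ...   | inj₁ (j , refl) | _ = return (gap (inj₂ j) , here≺gap , Z-t l l≤m j)
        ...   | inj₂ v<t | inj₁ (_ , no-rest) =
                  contradiction (≮-<-trans w≮x w<v , v<xs , v<t) (no-rest v)
        ...   | inj₂ v<t | inj₂ (inj₂ (d , _ , unbounded)) =
                  return (gap (inj₁ d) , here≺gap ,
                          Z-dense unbounded l l≤m d v (≮-<-trans w≮x w<v , v<xs , v<t))
        -- `here` does not lie above itself, so a skipped state is answered by the first listed one.
        -- Only `l` rounds remain and `l < m = k`, so the game ends before the list does.
        ...   | inj₂ v<t | inj₂ (inj₁ (_ , k≡m)) =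
                  return (gap (inj₂ i₀) , here≺gap ,
                          Z-before-t l l≤m i₀ room v (≮-<-trans w≮x w<v) v<xs (asym (v<t i₀)))
          where
          l<k : l ℕ.< k
          l<k = subst (l ℕ.<_) (sym k≡m) l<m
          0<k : 0 ℕ.< k
          0<k = ℕₚ.≤-<-trans z≤n l<k
          i₀ = fromℕ< 0<k
          room : l + toℕ i₀ ℕ.< k
          room = subst (ℕ._< k) (sym (trans (cong (l +_) (Finₚ.toℕ-fromℕ< 0<k)) (ℕₚ.+-identityʳ l))) l<k
        back : ∀ r → here Q.≺ r → ¬ ¬ (∃[ v ] (w < v × Zˣ l v r))
        back (gap (inj₁ d)) _ with rest
        ... | inj₁ (¬d , _) = contradiction d ¬d
        ... | inj₂ (inj₁ (¬d , _)) = contradiction d ¬d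
        ... | inj₂ (inj₂ (_ , _ , unbounded)) = dense d >>= λ (v , w<v , v-rest) →
                return (v , w<v , Z-dense unbounded l l≤m d v v-rest)
        back (gap (inj₂ j)) _ = return (t j , w<t j , Z-t l l≤m j)
        back (later s) _ = from-later l≤m w<xs s

      Z-x : Zˣ m x here
      Z-x = Z-here m ℕₚ.≤-refl x (<-irrefl refl) (λ _ → refl) (proj₁ asc) t-above dense
        where
        dense : Q.Block q → ¬ ¬ (∃[ v ] (x < v × Rest v))
        dense d with rest
        ... | inj₁ (¬d , _) = contradiction d ¬d
        ... | inj₂ (inj₁ (¬d , _)) = contradiction d ¬d
        ... | inj₂ (inj₂ (_ , inhabited , _)) =
                ¬¬-map (λ (v , v-rest) → v , proj₁ v-rest , v-rest) inhabited

      extended : Matched (x ∷ xs) (sh ∷ shs)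
      extended = record { to = to′ ; from = from′ ; point = point′ }
        where
        to′ : ∀ w → ¬ w < x → ¬ ¬ (∃[ s ] Zˣ m w s)
        to′ w w≮x with Below? xs w
        ... | no w≮xs = ¬¬-map (λ (s , z) → later s , z) (to-later ℕₚ.≤-refl w w≮xs)
        ... | yes w<xs with compare w x
        ...   | tri< w<x _ _ = contradiction w<x w≮x
        ...   | tri≈ _ refl _ = return (here , Z-x)
        ...   | tri> _ _ x<w with cover w x<w w<xs | rest
        ...     | inj₁ (i , refl) | _ = return (gap (inj₂ i) , Z-t m ℕₚ.≤-refl i)
        ...     | inj₂ w<t | inj₁ (_ , no-rest) = contradiction (x<w , w<xs , w<t) (no-rest w)
        ...     | inj₂ w<t | inj₂ (inj₁ (¬d , _)) =
                    return (here , Z-here m ℕₚ.≤-refl w w≮x (anonymous x<w w<xs) w<xs w<t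
                                          (λ d → contradiction d ¬d))
        ...     | inj₂ w<t | inj₂ (inj₂ (d , _ , unbounded)) =
                    return (gap (inj₁ d) , Z-dense unbounded m ℕₚ.≤-refl d w (x<w , w<xs , w<t))
        above : ∀ {w} → x < w → ¬ w < x
        above x<w w<x = asym x<w w<x
        from′ : ∀ s → ¬ ¬ (∃[ w ] (¬ w < x × Zˣ m w s))
        from′ here = return (x , <-irrefl refl , Z-x)
        from′ (gap (inj₁ d)) with rest
        ... | inj₁ (¬d , _) = contradiction d ¬d
        ... | inj₂ (inj₁ (¬d , _)) = contradiction d ¬d
        ... | inj₂ (inj₂ (_ , inhabited , unbounded)) = inhabited >>= λ (v , v-rest) →
                return (v , above (proj₁ v-rest) , Z-dense unbounded m ℕₚ.≤-refl d v v-rest)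
        from′ (gap (inj₂ i)) = return (t i , above (t-above i) , Z-t m ℕₚ.≤-refl i)
        from′ (later s) =
          ¬¬-map (λ (w , x<w , z) → w , above x<w , z) (from-later ℕₚ.≤-refl (proj₁ asc) s)
        point′ : ∀ j → Zˣ m (lookup (x ∷ xs) j) (Q.pointAt (sh ∷ shs) j)
        point′ zero    = Z-x
        point′ (suc j) = Z-later m (point j)

    -- The gap is peeled from the top: as long as the remaining states have a greatest element, it
    -- is put in front of the list, at most `m` times.
    explore : ∀ {n} x (xs : Vec W n) → ¬ ¬ (∃[ sh ] (proj₂ sh ≤ m × GapData x xs sh))
    explore x xs = go m zero (ℕₚ.+-identityʳ m) Vector.[] (λ ()) (λ ()) (λ {i} → contradiction i λ ())
                      (λ _ _ _ → inj₂ λ ())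
      where
      go : ∀ fuel k → fuel + k ≡ m → (t : Fin k → W) → (∀ i → x < t i) → (∀ i → Below xs (t i)) →
           (∀ {i j} → i Fin.< j → t i < t j) →
           (∀ v → x < v → Below xs v → (∃[ i ] v ≡ t i) ⊎ (∀ i → v < t i)) →
           ¬ ¬ (∃[ sh ] (proj₂ sh ≤ m × GapData x xs sh))
      -- Here `k` has reached `m`; whatever precedes the listed states is skipped.
      go zero k refl t above below mono cover = return ((false , k) , ℕₚ.≤-refl ,
        record { t = t ; t-above = above ; t-below = below ; t-mono = mono ; cover = cover
               ; rest = inj₂ (inj₁ (id , refl)) })
      go (suc f) k eq t above below mono cover =
        -- Whether a greatest remaining state exists is undecidable in general, which is why the
        -- result stands under a double negation.
        ¬¬-excluded-middle {A = ∃[ p ] (Rest p × (∀ v → Rest v → ¬ p < v))} >>= λ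
          { (yes (p , (x<p , p<xs , p<t) , p-max)) →
              go f (suc k) (trans (ℕₚ.+-suc f k) eq) (p Vector.∷ t)
                 (λ { zero → x<p ; (suc i) → above i })
                 (λ { zero → p<xs ; (suc i) → below i })
                 (λ { {zero} {suc j} _ → p<t j ; {suc i} {suc j} (s≤s i<j) → mono i<j })
                 (cover′ p p-max)
          ; (no no-max) → ¬¬-excluded-middle {A = ∃ Rest} >>= λ
              { (no none) → return ((false , k) , k≤m ,
                  record { t = t ; t-above = above ; t-below = below ; t-mono = mono ; cover = cover
                         ; rest = inj₁ (id , λ v r → none (v , r)) })
              ; (yes some) → return ((true , k) , k≤m ,
                  record { t = t ; t-above = above ; t-below = below ; t-mono = mono ; cover = cover
                         ; rest = inj₂ (inj₂ (tt , return some , λ v v-rest bounded →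
                             no-max (v , v-rest , λ u u-rest v<u → bounded (u , v<u , u-rest)))) })
              }
          }
        where
        Rest : W → Set
        Rest v = x < v × Below xs v × (∀ i → v < t i)
        k≤m : k ≤ m
        k≤m = ℕₚ.m+n≤o⇒n≤o (suc f) (ℕₚ.≤-reflexive eq)
        cover′ : ∀ p → (∀ v → Rest v → ¬ p < v) → ∀ v → x < v → Below xs v →
                 (∃[ i ] v ≡ (p Vector.∷ t) i) ⊎ (∀ i → v < (p Vector.∷ t) i)
        cover′ p p-max v x<v v<xs with cover v x<v v<xs
        ... | inj₁ (i , eq) = inj₁ (suc i , eq)
        ... | inj₂ v<t with compare v p
        ...   | tri< v<p _ _ = inj₂ λ { zero → v<p ; (suc i) → v<t i }
        ...   | tri≈ _ v≡p _ = inj₁ (zero , v≡p)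
        ...   | tri> _ _ p<v = contradiction p<v (p-max v (x<v , v<xs , v<t))

    module _ (Admissible : ℕ → Shape → Set) where

      match : (∀ {n} x (xs : Vec W n) → ¬ ¬ (∃[ sh ] (Admissible n sh × GapData x xs sh))) →
              ∀ {n} (xs : Vec W n) → Asc xs → Complete xs →
              ¬ ¬ (∃[ shs ] (AllAdmissible Admissible shs × Matched xs shs))
      match gaps [] asc complete = return ([] , tt , record
        { to = λ _ w≮ → contradiction tt w≮ ; from = λ () ; point = λ () })
      match gaps (x ∷ xs) asc complete =
        gaps x xs >>= λ (sh , adm , gd) →
        match gaps xs (proj₂ asc) (Complete-tail asc complete) >>= λ (shs , adms , matched) →
        return (sh ∷ shs , (adm , adms) , Extend.extended asc complete gd matched)

-- Decidability of satisfaction in the quotient.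

-- Omniscience of a finite type, used in place of an enumeration of its elements.
Searchable : Set → Set₁
Searchable A = ∀ {P : A → Set} → Unary.Decidable P → Dec (∃ P)

Searchable-∀ : ∀ {A} → Searchable A → ∀ {P : A → Set} → Unary.Decidable P → Dec (∀ a → P a)
Searchable-∀ search {P} P? with search (λ a → ¬? (P? a))
... | yes (a , ¬pa) = no λ p → ¬pa (p a)
... | no  none      = yes λ a → decidable-stable (P? a) (λ ¬pa → none (a , ¬pa))

Searchable-⊎ : ∀ {A B} → Searchable A → Searchable B → Searchable (A ⊎ B)
Searchable-⊎ searchA searchB P? = map′
  (λ { (inj₁ (a , p)) → inj₁ a , p ; (inj₂ (b , p)) → inj₂ b , p })
  (λ { (inj₁ a , p) → inj₁ (a , p) ; (inj₂ b , p) → inj₂ (b , p) })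
  (searchA (P? ∘ inj₁) ⊎-dec searchB (P? ∘ inj₂))

module _ where
  open Q

  searchBlock : ∀ q → Searchable (Block q)
  searchBlock true  P? = map′ (tt ,_) proj₂ (P? tt)
  searchBlock false P? = no λ ()

  searchChain : ∀ {n} (shs : Vec Shape n) → Searchable (Chain shs)
  searchChain []               P? = no λ ()
  searchChain ((q , k) ∷ shs) P? = map′
    (λ { (inj₁ p) → here , p ; (inj₂ (inj₁ (g , p))) → gap g , p
       ; (inj₂ (inj₂ (s , p))) → later s , p })
    (λ { (here , p) → inj₁ p ; (gap g , p) → inj₂ (inj₁ (g , p))
       ; (later s , p) → inj₂ (inj₂ (s , p)) })
    (P? here ⊎-dec (Searchable-⊎ (searchBlock q) Finₚ.any? (P? ∘ gap)
            ⊎-dec searchChain shs (P? ∘ later)))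

  Block-≟ : ∀ q → DecidableEquality (Block q)
  Block-≟ true tt tt = yes refl

  infix 4 _≟_ _≺?_

  _≟_ : ∀ {n} {shs : Vec Shape n} → DecidableEquality (Chain shs)
  here    ≟ here    = yes refl
  here    ≟ gap _   = no λ ()
  here    ≟ later _ = no λ ()
  gap _   ≟ here    = no λ ()
  _≟_ {shs = (q , k) ∷ _} (gap g) (gap h) =
    map′ (cong gap) (λ { refl → refl }) (≡-dec (Block-≟ q) Finₚ._≟_ g h)
  gap _   ≟ later _ = no λ ()
  later _ ≟ here    = no λ ()
  later _ ≟ gap _   = no λ ()
  later s ≟ later r = map′ (cong later) (λ { refl → refl }) (s ≟ r)

  _≺?_ : ∀ {n} {shs : Vec Shape n} → Decidable (_≺_ {shs = shs})
  here    ≺? here    = no λ ()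
  here    ≺? gap _   = yes here≺gap
  here    ≺? later _ = yes here≺later
  gap _   ≺? here    = no λ ()
  _≺?_ {shs = (q , k) ∷ _} (gap g) (gap h) =
    map′ gap≺gap (λ { (gap≺gap g<h) → g<h })
         (⊎-<-decidable (λ d e → yes (Q-Block<-total q d e)) Finₚ._<?_ g h)
  gap _   ≺? later _ = yes gap≺later
  later _ ≺? here    = no λ ()
  later _ ≺? gap _   = no λ ()
  later s ≺? later r = map′ later≺later (λ { (later≺later s≺r) → s≺r }) (s ≺? r)

module Satisfaction {NOM : Set} {n} {shs : Vec Shape n} (ρ : NOM → Q.Chain shs) where

  Sat : Q.Chain shs → MHL NOM → Set
  Sat s (nom i)  = ρ i ≡ s
  Sat s ⊤ᶠ       = ⊤
  Sat s ⊥ᶠ       = ⊥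
  Sat s (φ ∧ᶠ ψ) = Sat s φ × Sat s ψ
  Sat s (φ ∨ᶠ ψ) = Sat s φ ⊎ Sat s ψ
  Sat s (◇ φ)    = ∃[ r ] (s Q.≺ r × Sat r φ)
  Sat s (□ φ)    = ∀ r → s Q.≺ r → Sat r φ
  Sat s (at i φ) = Sat (ρ i) φ

  Sat? : ∀ s φ → Dec (Sat s φ)
  Sat? s (nom i)  = ρ i ≟ s
  Sat? s ⊤ᶠ       = yes tt
  Sat? s ⊥ᶠ       = no λ ()
  Sat? s (φ ∧ᶠ ψ) = Sat? s φ ×-dec Sat? s ψ
  Sat? s (φ ∨ᶠ ψ) = Sat? s φ ⊎-dec Sat? s ψ
  Sat? s (◇ φ)    = searchChain shs (λ r → s ≺? r ×-dec Sat? r φ)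
  Sat? s (□ φ)    = Searchable-∀ (searchChain shs) (λ r → s ≺? r →-dec Sat? r φ)
  Sat? s (at i φ) = Sat? (ρ i) φ

-- From the game to satisfaction in the quotient.

nominals : {NOM : Set} → MHL NOM → List NOM
nominals (nom i)  = i ∷ []
nominals ⊤ᶠ       = []
nominals ⊥ᶠ       = []
nominals (φ ∧ᶠ ψ) = nominals φ ++ nominals ψ
nominals (φ ∨ᶠ ψ) = nominals φ ++ nominals ψ
nominals (◇ φ)    = nominals φ
nominals (□ φ)    = nominals φ
nominals (at i φ) = i ∷ nominals φ

NamedBy : {NOM W : Set} → List NOM → (NOM → W) → W → Set
NamedBy is η w = ∃[ i ] (i ∈ is × η i ≡ w)

module Transfer {NOM : Set} (F : LinearFrame) (η : NOM → LinearFrame.W F) (is : List NOM) where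
  open LinearFrame F

  K : Model NOM
  K = record { frame = F ; η = η }

  open Game F (NamedBy is η)

  module _ {m n} {xs : Vec W n} {shs : Vec Shape n} (asc : Asc xs) (matched : Matched m xs shs)
           (idx : NOM → Fin n) (lookup-idx : ∀ {i} → i ∈ is → lookup xs (idx i) ≡ η i) where
    open Satisfaction (Q.pointAt shs ∘ idx)

    -- Each modality uses up one round. The game yields its replies only under a double negation,
    -- which is removed because `Sat` is decidable. Truth passes in one direction only, which
    -- suffices for positive formulas.
    Z⇒Sat : ∀ φ → (∀ {i} → i ∈ nominals φ → i ∈ is) → ∀ l → md φ ≤ l → l ≤ m →
            ∀ {w s} → Z xs l w s → K ∋ w ⊨ φ → Sat s φ
    Z⇒Sat (nom i) ⊆is l d≤l l≤m {s = s} z refl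
      -- The named state `w` is listed at `j` and at `idx i`; the points are distinct, so the two
      -- indices agree.
      with j , eq , eq′ ← At⇒lookup xs s (Z-nominal l z (i , ⊆is (here refl) , refl)) =
        trans (cong (Q.pointAt shs)
                    (Asc-injective asc _ _ (trans (lookup-idx (⊆is (here refl))) (sym eq)))) eq′
    Z⇒Sat ⊤ᶠ ⊆is l d≤l l≤m z _ = tt
    Z⇒Sat (φ ∧ᶠ ψ) ⊆is l d≤l l≤m z (p , q) =
      Z⇒Sat φ (⊆is ∘ ∈-++⁺ˡ) l (ℕₚ.m⊔n≤o⇒m≤o (md φ) (md ψ) d≤l) l≤m z p ,
      Z⇒Sat ψ (⊆is ∘ ∈-++⁺ʳ (nominals φ)) l (ℕₚ.m⊔n≤o⇒n≤o (md φ) (md ψ) d≤l) l≤m z q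
    Z⇒Sat (φ ∨ᶠ ψ) ⊆is l d≤l l≤m z (inj₁ p) =
      inj₁ (Z⇒Sat φ (⊆is ∘ ∈-++⁺ˡ) l (ℕₚ.m⊔n≤o⇒m≤o (md φ) (md ψ) d≤l) l≤m z p)
    Z⇒Sat (φ ∨ᶠ ψ) ⊆is l d≤l l≤m z (inj₂ q) =
      inj₂ (Z⇒Sat ψ (⊆is ∘ ∈-++⁺ʳ (nominals φ)) l (ℕₚ.m⊔n≤o⇒n≤o (md φ) (md ψ) d≤l) l≤m z q)
    Z⇒Sat (◇ φ) ⊆is (suc l) (s≤s d≤l) l<m {s = s} (_ , forth , _) (v , w<v , p) =
      decidable-stable (Sat? s (◇ φ)) (¬¬-map
        (λ (r , s≺r , z) → r , s≺r , Z⇒Sat φ ⊆is l d≤l (ℕₚ.<⇒≤ l<m) z p) (forth v w<v))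
    Z⇒Sat (□ φ) ⊆is (suc l) (s≤s d≤l) l<m (_ , _ , back) p r s≺r =
      decidable-stable (Sat? r φ) (¬¬-map
        (λ (v , w<v , z) → Z⇒Sat φ ⊆is l d≤l (ℕₚ.<⇒≤ l<m) z (p v w<v)) (back r s≺r))
    Z⇒Sat (at i φ) ⊆is l d≤l l≤m z p =
      -- After the jump the play continues from a matched point, with the round counter set back to
      -- `m`.
      Z⇒Sat φ (⊆is ∘ there) m (ℕₚ.≤-trans d≤l l≤m) ℕₚ.≤-refl
            (subst (λ w → Z xs m w (Q.pointAt shs (idx i))) (lookup-idx (⊆is (here refl)))
                   (Matched.point matched (idx i))) p

-- Search through the candidate shapes.

searchShapes : (Admissible : ℕ → Shape → Set) →
  (∀ n {P : Shape → Set} → Unary.Decidable P → Dec (∃[ sh ] (Admissible n sh × P sh))) →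
  ∀ n {P : Vec Shape n → Set} → Unary.Decidable P →
  Dec (∃[ shs ] (AllAdmissible Admissible shs × P shs))
searchShapes Admissible search zero P? =
  map′ (λ p → [] , tt , p) (λ { ([] , tt , p) → p }) (P? [])
searchShapes Admissible search (suc n) P? = map′
  (λ (sh , adm , shs , adms , p) → sh ∷ shs , (adm , adms) , p)
  (λ { (sh ∷ shs , (adm , adms) , p) → sh , adm , shs , adms , p })
  (search n (λ sh → searchShapes Admissible search n (λ shs → P? (sh ∷ shs))))

searchBounded : ∀ m {P : ℕ → Set} → Unary.Decidable P → Dec (∃[ k ] (k ≤ m × P k))
searchBounded m P? = map′
  (λ { (k , s≤s k≤m , p) → k , k≤m , p }) (λ (k , k≤m , p) → k , s≤s k≤m , p)
  (ℕₚ.anyUpTo? P? (suc m))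

-- Chains are strictly totally ordered.

⊎-<-isStrictTotalOrder : {A B : Set} {_<₁_ : Rel A 0ℓ} {_<₂_ : Rel B 0ℓ} →
  IsStrictTotalOrder _≡_ _<₁_ → IsStrictTotalOrder _≡_ _<₂_ →
  IsStrictTotalOrder _≡_ (_<₁_ ⊎-< _<₂_)
⊎-<-isStrictTotalOrder {_<₁_ = _<₁_} {_<₂_} sto₁ sto₂ = record
  { isStrictPartialOrder = record
    { isEquivalence = isEquivalence
    ; irrefl = λ { refl (₁∼₁ a<a) → O₁.irrefl refl a<a ; refl (₂∼₂ b<b) → O₂.irrefl refl b<b }
    ; trans = ⊎-trans
    ; <-resp-≈ = resp₂ _ }
  ; compare = cmp }
  where
  module O₁ = IsStrictTotalOrder sto₁
  module O₂ = IsStrictTotalOrder sto₂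
  ⊎-trans : Transitive (_<₁_ ⊎-< _<₂_)
  ⊎-trans ₁∼₂       (₂∼₂ _)   = ₁∼₂
  ⊎-trans (₁∼₁ _)   ₁∼₂       = ₁∼₂
  ⊎-trans (₁∼₁ a<b) (₁∼₁ b<c) = ₁∼₁ (O₁.trans a<b b<c)
  ⊎-trans (₂∼₂ a<b) (₂∼₂ b<c) = ₂∼₂ (O₂.trans a<b b<c)
  cmp : Trichotomous _≡_ (_<₁_ ⊎-< _<₂_)
  cmp (inj₁ a) (inj₁ b) with O₁.compare a b
  ... | tri< a<b a≢b b≮a = tri< (₁∼₁ a<b) (a≢b ∘ inj₁-injective) λ { (₁∼₁ b<a) → b≮a b<a }
  ... | tri≈ a≮b a≡b b≮a =
          tri≈ (λ { (₁∼₁ a<b) → a≮b a<b }) (cong inj₁ a≡b) λ { (₁∼₁ b<a) → b≮a b<a }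
  ... | tri> a≮b a≢b b<a = tri> (λ { (₁∼₁ a<b) → a≮b a<b }) (a≢b ∘ inj₁-injective) (₁∼₁ b<a)
  cmp (inj₁ a) (inj₂ b) = tri< ₁∼₂ (λ ()) λ ()
  cmp (inj₂ a) (inj₁ b) = tri> (λ ()) (λ ()) ₁∼₂
  cmp (inj₂ a) (inj₂ b) with O₂.compare a b
  ... | tri< a<b a≢b b≮a = tri< (₂∼₂ a<b) (a≢b ∘ inj₂-injective) λ { (₂∼₂ b<a) → b≮a b<a }
  ... | tri≈ a≮b a≡b b≮a =
          tri≈ (λ { (₂∼₂ a<b) → a≮b a<b }) (cong inj₂ a≡b) λ { (₂∼₂ b<a) → b≮a b<a }
  ... | tri> a≮b a≢b b<a = tri> (λ { (₂∼₂ a<b) → a≮b a<b }) (a≢b ∘ inj₂-injective) (₂∼₂ b<a)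

module ChainProperties {D : Set} {_<ᴰ_ : Rel D 0ℓ} (sto : IsStrictTotalOrder _≡_ _<ᴰ_) where
  open Chains D _<ᴰ_

  Block<-isStrictTotalOrder : ∀ q → IsStrictTotalOrder _≡_ (Block< q)
  Block<-isStrictTotalOrder true  = sto
  Block<-isStrictTotalOrder false = record
    { isStrictPartialOrder = record
      { isEquivalence = isEquivalence ; irrefl = λ { {()} } ; trans = λ { {()} }
      ; <-resp-≈ = resp₂ _ }
    ; compare = λ () }

  module Gap {sh} = IsStrictTotalOrder
    (⊎-<-isStrictTotalOrder (Block<-isStrictTotalOrder (proj₁ sh)) (Finₚ.<-isStrictTotalOrder {proj₂ sh}))

  ≺-irrefl : ∀ {n} {shs : Vec Shape n} {s : Chain shs} → ¬ s ≺ s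
  ≺-irrefl (gap≺gap g<g)     = Gap.irrefl refl g<g
  ≺-irrefl (later≺later s≺s) = ≺-irrefl s≺s

  ≺-trans : ∀ {n} {shs : Vec Shape n} → Transitive (_≺_ {shs = shs})
  ≺-trans here≺gap          (gap≺gap _)       = here≺gap
  ≺-trans here≺gap          gap≺later         = here≺later
  ≺-trans here≺later        (later≺later _)   = here≺later
  ≺-trans (gap≺gap g<h)     (gap≺gap h<i)     = gap≺gap (Gap.trans g<h h<i)
  ≺-trans (gap≺gap _)       gap≺later         = gap≺later
  ≺-trans gap≺later         (later≺later _)   = gap≺later
  ≺-trans (later≺later s≺r) (later≺later r≺t) = later≺later (≺-trans s≺r r≺t)

  ≺-compare : ∀ {n} {shs : Vec Shape n} → Trichotomous _≡_ (_≺_ {shs = shs})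
  ≺-compare here      here      = tri≈ (λ ()) refl λ ()
  ≺-compare here      (gap _)   = tri< here≺gap (λ ()) λ ()
  ≺-compare here      (later _) = tri< here≺later (λ ()) λ ()
  ≺-compare (gap _)   here      = tri> (λ ()) (λ ()) here≺gap
  ≺-compare (gap g)   (gap h) with Gap.compare g h
  ... | tri< g<h g≢h h≮g = tri< (gap≺gap g<h) (λ { refl → g≢h refl }) λ { (gap≺gap h<g) → h≮g h<g }
  ... | tri≈ g≮h g≡h h≮g =
          tri≈ (λ { (gap≺gap g<h) → g≮h g<h }) (cong gap g≡h) λ { (gap≺gap h<g) → h≮g h<g }
  ... | tri> g≮h g≢h h<g = tri> (λ { (gap≺gap g<h) → g≮h g<h }) (λ { refl → g≢h refl }) (gap≺gap h<g)
  ≺-compare (gap _)   (later _) = tri< gap≺later (λ ()) λ ()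
  ≺-compare (later _) here      = tri> (λ ()) (λ ()) here≺later
  ≺-compare (later _) (gap _)   = tri> (λ ()) (λ ()) gap≺later
  ≺-compare (later s) (later r) with ≺-compare s r
  ... | tri< s≺r s≢r r⊀s =
          tri< (later≺later s≺r) (λ { refl → s≢r refl }) λ { (later≺later r≺s) → r⊀s r≺s }
  ... | tri≈ s⊀r s≡r r⊀s =
          tri≈ (λ { (later≺later s≺r) → s⊀r s≺r }) (cong later s≡r) λ { (later≺later r≺s) → r⊀s r≺s }
  ... | tri> s⊀r s≢r r≺s =
          tri> (λ { (later≺later s≺r) → s⊀r s≺r }) (λ { refl → s≢r refl }) (later≺later r≺s)

  ≺-isStrictTotalOrder : ∀ {n} {shs : Vec Shape n} → IsStrictTotalOrder _≡_ (_≺_ {shs = shs})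
  ≺-isStrictTotalOrder = record
    { isStrictPartialOrder = record
      { isEquivalence = isEquivalence ; irrefl = λ { refl → ≺-irrefl } ; trans = ≺-trans
      ; <-resp-≈ = resp₂ _ }
    ; compare = ≺-compare }

-- Gaps as intervals of a chain.

module Fill (D : Set) (_<ᴰ_ : Rel D 0ℓ) where
  open Chains D _<ᴰ_

  pointAt-mono : ∀ {n} (shs : Vec Shape n) {i j} → i Fin.< j → pointAt shs i ≺ pointAt shs j
  pointAt-mono (sh ∷ shs) {zero}  {suc j} _         = here≺later
  pointAt-mono (sh ∷ shs) {suc i} {suc j} (s≤s i<j) = later≺later (pointAt-mono shs i<j)

  pointAt-cancel : ∀ {n} (shs : Vec Shape n) {i j} → pointAt shs i ≺ pointAt shs j → i Fin.< j
  pointAt-cancel (sh ∷ shs) {zero}  {suc j} _               = s≤s z≤n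
  pointAt-cancel (sh ∷ shs) {suc i} {suc j} (later≺later p) = s≤s (pointAt-cancel shs p)

  fill : ∀ {n} (shs : Vec Shape n) j → Gap (lookup shs j) → Chain shs
  fill (sh ∷ shs) zero    g = gap g
  fill (sh ∷ shs) (suc j) g = later (fill shs j g)

  fill-mono : ∀ {n} (shs : Vec Shape n) j {g h} → Gap< (lookup shs j) g h → fill shs j g ≺ fill shs j h
  fill-mono (sh ∷ shs) zero    g<h = gap≺gap g<h
  fill-mono (sh ∷ shs) (suc j) g<h = later≺later (fill-mono shs j g<h)

  fill-cancel : ∀ {n} (shs : Vec Shape n) j {g h} → fill shs j g ≺ fill shs j h → Gap< (lookup shs j) g h
  fill-cancel (sh ∷ shs) zero    (gap≺gap g<h)   = g<h
  fill-cancel (sh ∷ shs) (suc j) (later≺later p) = fill-cancel shs j p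

  fill-injective : ∀ {n} (shs : Vec Shape n) j {g h} → fill shs j g ≡ fill shs j h → g ≡ h
  fill-injective (sh ∷ shs) zero    refl = refl
  fill-injective (sh ∷ shs) (suc j) eq   = fill-injective shs j (later-injective eq)
    where
    later-injective : ∀ {s r : Chain shs} → later {sh = sh} s ≡ later r → s ≡ r
    later-injective refl = refl

  fill-above : ∀ {n} (shs : Vec Shape n) j g → pointAt shs j ≺ fill shs j g
  fill-above (sh ∷ shs) zero    g = here≺gap
  fill-above (sh ∷ shs) (suc j) g = later≺later (fill-above shs j g)

  fill-below : ∀ {n} (shs : Vec Shape n) {i j} g → i Fin.< j → fill shs i g ≺ pointAt shs j
  fill-below (sh ∷ shs) {zero}  {suc j} g _         = gap≺later
  fill-below (sh ∷ shs) {suc i} {suc j} g (s≤s i<j) = later≺later (fill-below shs g i<j)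

  -- For neighbouring points, a state `later s` below the upper one would have to precede `here`,
  -- the least state of the remaining chain.
  fill-surjective : ∀ {n} (shs : Vec Shape n) {i j} → toℕ j ≡ suc (toℕ i) →
                    ∀ s → pointAt shs i ≺ s → s ≺ pointAt shs j → ∃[ g ] fill shs i g ≡ s
  fill-surjective (sh ∷ shs)       {zero} {suc j}       _  (gap g)   _ _ = g , refl
  fill-surjective (sh ∷ sh′ ∷ shs) {zero} {suc zero}    _  (later s) _ (later≺later ())
  fill-surjective (sh ∷ sh′ ∷ shs) {zero} {suc (suc j)} ()
  fill-surjective (sh ∷ shs) {suc i} {suc j} eq (later s) (later≺later i≺s) (later≺later s≺j)
    with g , refl ← fill-surjective shs (ℕₚ.suc-injective eq) s i≺s s≺j = g , refl

-- The bounded morphism from a chain onto its quotient.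

module Collapse {D : Set} {_<ᴰ_ : Rel D 0ℓ} (d₀ : D) (serial : ∀ d → ∃[ e ] d <ᴰ e) where
  open Chains D _<ᴰ_

  block : ∀ q → Block q → Q.Block q
  block true d = tt

  collapse : ∀ {n} {shs : Vec Shape n} → Chain shs → Q.Chain shs
  collapse here               = here
  collapse (gap (inj₁ d))     = gap (inj₁ (block _ d))
  collapse (gap (inj₂ i))     = gap (inj₂ i)
  collapse (later s)          = later (collapse s)

  collapse-surjective : ∀ {n} {shs : Vec Shape n} (s : Q.Chain shs) → ∃[ r ] collapse r ≡ s
  collapse-surjective here = here , refl
  collapse-surjective {shs = (true , k) ∷ shs} (gap (inj₁ tt)) = gap (inj₁ d₀) , refl
  collapse-surjective (gap (inj₂ i)) = gap (inj₂ i) , refl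
  collapse-surjective (later s) with r , refl ← collapse-surjective s = later r , refl

  collapse-mono : ∀ {n} {shs : Vec Shape n} {r s : Chain shs} → r ≺ s → collapse r Q.≺ collapse s
  collapse-mono (here≺gap {g = inj₁ _})    = here≺gap
  collapse-mono (here≺gap {g = inj₂ _})    = here≺gap
  collapse-mono here≺later                 = here≺later
  collapse-mono {shs = (q , k) ∷ _} (gap≺gap (₁∼₁ _)) = gap≺gap (₁∼₁ (Q-Block<-total q _ _))
  collapse-mono (gap≺gap ₁∼₂)              = gap≺gap ₁∼₂
  collapse-mono (gap≺gap (₂∼₂ i<j))        = gap≺gap (₂∼₂ i<j)
  collapse-mono (gap≺later {g = inj₁ _})   = gap≺later
  collapse-mono (gap≺later {g = inj₂ _})   = gap≺later
  collapse-mono (later≺later r≺s)          = later≺later (collapse-mono r≺s)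

  -- The back condition. A step along the loop at a block state is lifted by `serial`; every other
  -- step is lifted by choosing any preimage of the target.
  collapse-back : ∀ {n} {shs : Vec Shape n} (r : Chain shs) {s} → collapse r Q.≺ s →
                  ∃[ t ] (r ≺ t × collapse t ≡ s)
  collapse-back here {gap g} here≺gap with collapse-surjective (gap g)
  ... | gap h , eq = gap h , here≺gap , eq
  collapse-back here {later s} here≺later with r , eq ← collapse-surjective s =
    later r , here≺later , cong later eq
  collapse-back {shs = (true , k) ∷ shs} (gap (inj₁ d)) {gap (inj₁ tt)} _
    with e , d<e ← serial d = gap (inj₁ e) , gap≺gap (₁∼₁ d<e) , refl
  collapse-back (gap (inj₁ d)) {gap (inj₂ j)} _ = gap (inj₂ j) , gap≺gap ₁∼₂ , refl
  collapse-back (gap (inj₂ i)) {gap (inj₂ j)} (gap≺gap (₂∼₂ i<j)) =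
    gap (inj₂ j) , gap≺gap (₂∼₂ i<j) , refl
  collapse-back (gap g) {later s} _ with r , eq ← collapse-surjective s =
    later r , gap≺later , cong later eq
  collapse-back (later r) (later≺later r≺s) with t , r≺t , refl ← collapse-back r r≺s =
    later t , later≺later r≺t , refl

  pointAt-collapse : ∀ {n} (shs : Vec Shape n) j → collapse (pointAt shs j) ≡ Q.pointAt shs j
  pointAt-collapse (sh ∷ shs) zero    = refl
  pointAt-collapse (sh ∷ shs) (suc j) = cong later (pointAt-collapse shs j)

  -- Only block states are identified with each other, so a point is its own sole preimage and
  -- nominals stay true at a single state.
  collapse-pointAt : ∀ {n} (shs : Vec Shape n) j r → Q.pointAt shs j ≡ collapse r → pointAt shs j ≡ r
  collapse-pointAt (sh ∷ shs) zero    here           eq = refl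
  collapse-pointAt (sh ∷ shs) zero    (gap (inj₁ d)) ()
  collapse-pointAt (sh ∷ shs) zero    (gap (inj₂ i)) ()
  collapse-pointAt (sh ∷ shs) (suc j) (gap (inj₁ d)) ()
  collapse-pointAt (sh ∷ shs) (suc j) (gap (inj₂ i)) ()
  collapse-pointAt (sh ∷ shs) (suc j) (later r) eq =
    cong later (collapse-pointAt shs j r (later-injective eq))
    where
    later-injective : ∀ {s r : Q.Chain shs} → later {sh = sh} s ≡ later r → s ≡ r
    later-injective refl = refl

-- From the quotient back to a model.

module Realise {NOM : Set} {D : Set} {_<ᴰ_ : Rel D 0ℓ}
  (d₀ : D) (serial : ∀ d → ∃[ e ] d <ᴰ e) {n} {shs : Vec Shape (suc n)} (idx : NOM → Fin (suc n))
  (F : LinearFrame) (e : Chains.Chain D _<ᴰ_ shs → LinearFrame.W F)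
  (iso : IsOrderIsomorphism _≡_ _≡_ (Chains._≺_ D _<ᴰ_) (LinearFrame._<_ F) e) where

  open Chains D _<ᴰ_
  open Fill D _<ᴰ_
  open Collapse d₀ serial
  open Satisfaction (Q.pointAt shs ∘ idx)
  open LinearFrame F
  open IsOrderIsomorphism iso using (mono; cancel; injective; surjective)

  K : Model NOM
  K = record { frame = F ; η = e ∘ pointAt shs ∘ idx }

  preimage : ∀ w → ∃[ r ] e r ≡ w
  preimage w = proj₁ (surjective w) , proj₂ (surjective w) refl

  -- Invariance of truth under the bounded morphism `collapse`, carried along the isomorphism `e`.
  Sat⇒⊨ : ∀ φ r → Sat (collapse r) φ → K ∋ e r ⊨ φ
  Sat⇒⊨ (nom i)  r eq = cong e (collapse-pointAt shs (idx i) r eq)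
  Sat⇒⊨ ⊤ᶠ       r _ = tt
  Sat⇒⊨ (φ ∧ᶠ ψ) r (p , q) = Sat⇒⊨ φ r p , Sat⇒⊨ ψ r q
  Sat⇒⊨ (φ ∨ᶠ ψ) r (inj₁ p) = inj₁ (Sat⇒⊨ φ r p)
  Sat⇒⊨ (φ ∨ᶠ ψ) r (inj₂ q) = inj₂ (Sat⇒⊨ ψ r q)
  Sat⇒⊨ (◇ φ)    r (s , r≺s , p) with t , r≺t , refl ← collapse-back r r≺s =
    e t , mono r≺t , Sat⇒⊨ φ t p
  Sat⇒⊨ (□ φ)    r p w r<w with t , refl ← preimage w =
    Sat⇒⊨ φ t (p (collapse t) (collapse-mono (cancel r<w)))
  Sat⇒⊨ (at i φ) r p =
    Sat⇒⊨ φ (pointAt shs (idx i)) (subst (λ s → Sat s φ) (sym (pointAt-collapse shs (idx i))) p)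

  satisfied : ∀ φ → ∃[ s ] Sat s φ → K satisfies φ
  satisfied φ (s , p) with r , refl ← collapse-surjective s = e r , Sat⇒⊨ φ r p

  GapIso : W → W → Shape → Set
  GapIso a b sh = ∃[ f ] IsOrderIsomorphism {A = Gap sh} _≡_ (≈ᴵ F a b) (Gap< sh) (<ᴵ F a b) f

  gapIso : ∀ {i j} → toℕ j ≡ suc (toℕ i) → GapIso (e (pointAt shs i)) (e (pointAt shs j)) (lookup shs i)
  gapIso {i} {j} eq = f , record
    { isOrderMonomorphism = record
      { isOrderHomomorphism = record
        { cong = cong (e ∘ fill shs i)
        ; mono = mono ∘ fill-mono shs i }
      ; injective = fill-injective shs i ∘ injective
      ; cancel = fill-cancel shs i ∘ cancel }
    ; surjective = f-surjective }
    where
    a = e (pointAt shs i)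
    b = e (pointAt shs j)
    f : Gap (lookup shs i) → Interval F a b
    f g = e (fill shs i g) , mono (fill-above shs i g) ,
          mono (fill-below shs g (ℕₚ.≤-reflexive (sym eq)))
    f-surjective : ∀ y → ∃[ g ] (∀ {h} → h ≡ g → e (fill shs i h) ≡ proj₁ y)
    f-surjective (y , a<y , y<b)
      with r , refl ← preimage y
      with g , refl ← fill-surjective shs eq r (cancel a<y) (cancel y<b) = g , λ { refl → refl }

  module _ (named : ∀ j → ∃[ i ] idx i ≡ suc j) where

    -- All points but possibly the first are nominal states, so a point strictly between the two
    -- would be a nominal state between them.
    consecutive : ∀ {i j} → ConsecutiveNominals K (e (pointAt shs (idx i))) (e (pointAt shs (idx j))) →
                  toℕ (idx j) ≡ suc (toℕ (idx i))
    consecutive {i} {j} (_ , _ , a<b , none-between) with ℕₚ.<-cmp (suc (toℕ (idx i))) (toℕ (idx j))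
    ... | tri≈ _ eq _ = sym eq
    ... | tri> _ _ (s≤s j≤i) = contradiction (pointAt-cancel shs (cancel a<b)) (ℕₚ.≤⇒≯ j≤i)
    ... | tri< i⁺<j _ _ = contradiction
            (mono (pointAt-mono shs i<l) , mono (pointAt-mono shs l<j))
            (none-between (e (pointAt shs (idx l))) (l , refl))
      where
      i<n : toℕ (idx i) ℕ.< n
      i<n = ℕₚ.≤-pred (ℕₚ.<-trans i⁺<j (Finₚ.toℕ<n (idx j)))
      -- A nominal for the point with the next index; `named` adds the `suc`.
      l = proj₁ (named (fromℕ< i<n))
      toℕ-l : toℕ (idx l) ≡ suc (toℕ (idx i))
      toℕ-l = trans (cong toℕ (proj₂ (named (fromℕ< i<n)))) (cong suc (Finₚ.toℕ-fromℕ< i<n))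
      i<l : idx i Fin.< idx l
      i<l = ℕₚ.≤-reflexive (sym toℕ-l)
      l<j : idx l Fin.< idx j
      l<j = subst (ℕ._< toℕ (idx j)) (sym toℕ-l) i⁺<j

    quasiQuadratic : ∀ {m} →
      (∀ {i j} → toℕ j ≡ suc (toℕ i) → ∀ {a b} → GapIso a b (lookup shs i) →
        ∃[ k ] (k ≤ m × (ConsistsOf F a b k ⊎ ConsistsOfℚThen F a b k))) →
      QuasiQuadraticIn K m
    quasiQuadratic sizes _ _ consec@((i , refl) , (j , refl) , _) =
      sizes (consecutive consec) (gapIso (consecutive consec))

-- The order types of gaps, and the rational interval.

module Sizes {D : Set} {_<ᴰ_ : Rel D 0ℓ} (F : LinearFrame) {a b : LinearFrame.W F} where
  open Chains D _<ᴰ_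

  consistsOf : ∀ {k} →
    ∃[ f ] IsOrderIsomorphism {A = Gap (false , k)} _≡_ (≈ᴵ F a b) (Gap< (false , k)) (<ᴵ F a b) f →
    ConsistsOf F a b k
  consistsOf {k} (f , iso) = f ∘ inj₂ , record
    { isOrderMonomorphism = record
      { isOrderHomomorphism = record { cong = I.cong ∘ cong inj₂ ; mono = I.mono ∘ ₂∼₂ }
      ; injective = inj₂-injective ∘ I.injective
      ; cancel = drop-inj₂ ∘ I.cancel }
    ; surjective = surj }
    where
    module I = IsOrderIsomorphism iso
    surj : ∀ y → ∃[ i ] (∀ {j} → j ≡ i → ≈ᴵ F a b (f (inj₂ j)) y)
    surj y with I.surjective y
    ... | inj₂ i , eq = i , eq ∘ cong inj₂

-- Proofs of `<` between rationals are unique, so the interval is strictly totally ordered with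
-- respect to `_≡_`, as frames require.
⟨0,1⟩ℚ-≡ : ∀ {x y : ⟨0,1⟩ℚ} → x ≈₀₁ y → x ≡ y
⟨0,1⟩ℚ-≡ {_ , p , q} {_ , p′ , q′} refl =
  cong₂ (λ p q → _ , p , q) (ℚₚ.<-irrelevant p p′) (ℚₚ.<-irrelevant q q′)

<₀₁-isStrictTotalOrder : IsStrictTotalOrder _≡_ _<₀₁_
<₀₁-isStrictTotalOrder = record
  { isStrictPartialOrder = record
    { isEquivalence = isEquivalence ; irrefl = λ { refl → ℚₚ.<-irrefl refl } ; trans = ℚₚ.<-trans
    ; <-resp-≈ = resp₂ _ }
  ; compare = cmp }
  where
  cmp : Trichotomous _≡_ _<₀₁_
  cmp x y with ℚₚ.<-cmp (proj₁ x) (proj₁ y)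
  ... | tri< x<y x≢y y≮x = tri< x<y (x≢y ∘ cong proj₁) y≮x
  ... | tri≈ x≮y x≡y y≮x = tri≈ x≮y (⟨0,1⟩ℚ-≡ x≡y) y≮x
  ... | tri> x≮y x≢y y<x = tri> x≮y (x≢y ∘ cong proj₁) y<x

½₀₁ : ⟨0,1⟩ℚ
½₀₁ = ℚ.½ , toWitness {a? = 0ℚ ℚₚ.<? ℚ.½} tt , toWitness {a? = ℚ.½ ℚₚ.<? 1ℚ} tt

<₀₁-serial : ∀ x → ∃[ y ] x <₀₁ y
<₀₁-serial (x , 0<x , x<1) with y , x<y , y<1 ← ℚₚ.<-dense x<1 =
  (y , ℚₚ.<-trans 0<x x<y , y<1) , x<y

consistsOfℚThen : ∀ F {a b k} → let open Chains ⟨0,1⟩ℚ _<₀₁_ in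
  ∃[ f ] IsOrderIsomorphism {A = Gap (true , k)} _≡_ (≈ᴵ F a b) (Gap< (true , k)) (<ᴵ F a b) f →
  ConsistsOfℚThen F a b k
consistsOfℚThen F (f , iso) = f , record
  { isOrderMonomorphism = record
    { isOrderHomomorphism = record { cong = I.cong ∘ pointwise-≡ ; mono = I.mono }
    ; injective = ≡-pointwise ∘ I.injective
    ; cancel = I.cancel }
  ; surjective = λ y → proj₁ (I.surjective y) , proj₂ (I.surjective y) ∘ pointwise-≡ }
  where
  module I = IsOrderIsomorphism iso
  pointwise-≡ : ∀ {g h} → Pointwise _≈₀₁_ _≡_ g h → g ≡ h
  pointwise-≡ (inj₁ x≈y) = cong inj₁ (⟨0,1⟩ℚ-≡ x≈y)
  pointwise-≡ (inj₂ i≡j) = cong inj₂ i≡j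
  ≡-pointwise : ∀ {g h} → g ≡ h → Pointwise _≈₀₁_ _≡_ g h
  ≡-pointwise {inj₁ _} refl = inj₁ refl
  ≡-pointwise {inj₂ _} refl = inj₂ refl

-- Sorting the named states.

module Points (F : LinearFrame) (Nom : LinearFrame.W F → Set) where
  open LinearFrame F
  open Game F Nom
  open IsStrictTotalOrder isStrictTotalOrder using (compare) renaming (trans to <-trans; irrefl to <-irrefl)

  -- Insertion without duplicates that keeps `p` in front. The last two components trace the old
  -- entries to their new places and every entry behind `p` to its origin.
  insert : ∀ {n p} (xs : Vec W n) → Asc (p ∷ xs) → ∀ y → ¬ y < p →
    ∃[ n′ ] Σ[ ys ∈ Vec W n′ ] (Asc (p ∷ ys) × (∃[ j ] lookup (p ∷ ys) j ≡ y)
      × (∀ i → ∃[ j ] lookup (p ∷ ys) j ≡ lookup (p ∷ xs) i)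
      × (∀ j → lookup ys j ≡ y ⊎ (∃[ i ] lookup ys j ≡ lookup xs i)))
  insert {p = p} xs asc y y≮p with compare y p
  ... | tri< y<p _ _ = contradiction y<p y≮p
  ... | tri≈ _ refl _ = _ , xs , asc , (zero , refl) , (λ i → i , refl) , (λ j → inj₂ (j , refl))
  insert [] asc y y≮p | tri> _ _ p<y =
    _ , y ∷ [] , (p<y , tt , tt) , (suc zero , refl) , (λ { zero → zero , refl }) , (λ { zero → inj₁ refl })
  insert (x ∷ xs) (p<x , asc) y y≮p | tri> _ _ p<y with compare y x
  ... | tri< y<x _ _ = _ , y ∷ x ∷ xs , (p<y , y<x , asc) , (suc zero , refl) ,
          (λ { zero → zero , refl ; (suc i) → suc (suc i) , refl }) ,
          (λ { zero → inj₁ refl ; (suc j) → inj₂ (j , refl) })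
  ... | tri≈ _ refl _ = _ , x ∷ xs , (p<x , asc) , (suc zero , refl) , (λ i → i , refl) ,
          (λ j → inj₂ (j , refl))
  ... | tri> y≮x _ _ with n′ , ys , asc′ , (l , eq) , old , new ← insert xs asc y y≮x =
          _ , x ∷ ys , (p<x , asc′) , (suc l , eq) ,
          (λ { zero → zero , refl ; (suc i) → suc (proj₁ (old i)) , proj₂ (old i) }) , origin
    where
    origin : ∀ j → lookup (x ∷ ys) j ≡ y ⊎ (∃[ i ] lookup (x ∷ ys) j ≡ lookup (x ∷ xs) i)
    origin zero = inj₂ (zero , refl)
    origin (suc j) with new j
    ... | inj₁ eq′ = inj₁ eq′
    ... | inj₂ (i , eq′) = inj₂ (suc i , eq′)

  module _ {NOM : Set} (η : NOM → W) where

    lowerBound : ∀ w is → ∃[ p ] (¬ w < p × (∀ {i} → i ∈ is → ¬ η i < p))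
    lowerBound w [] = w , <-irrefl refl , λ ()
    lowerBound w (i ∷ is) with p , w≮p , is≮p ← lowerBound w is with compare (η i) p
    ... | tri< i<p _ i≯p = η i , (λ w<i → w≮p (<-trans w<i i<p)) ,
            λ { (here refl) → <-irrefl refl ; (there j∈is) j<i → is≮p j∈is (<-trans j<i i<p) }
    ... | tri≈ i≮p _ _ = p , w≮p , λ { (here refl) → i≮p ; (there j∈is) → is≮p j∈is }
    ... | tri> i≮p _ _ = p , w≮p , λ { (here refl) → i≮p ; (there j∈is) → is≮p j∈is }

    sortedPoints : ∀ p is → (∀ {i} → i ∈ is → ¬ η i < p) →
      ∃[ n ] Σ[ xs ∈ Vec W n ] (Asc (p ∷ xs)
        × (∀ {i} → i ∈ is → ∃[ j ] lookup (p ∷ xs) j ≡ η i)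
        × (∀ j → ∃[ i ] (i ∈ is × lookup xs j ≡ η i)))
    sortedPoints p [] _ = _ , [] , (tt , tt) , (λ ()) , λ ()
    sortedPoints p (i ∷ is) is≮p
      with n , xs , asc , index , named ← sortedPoints p is (is≮p ∘ there)
      with n′ , ys , asc′ , index-i , old , new ← insert xs asc (η i) (is≮p (here refl)) =
        n′ , ys , asc′ ,
        (λ { (here refl) → index-i
           ; (there j∈is) → let l , eq = index j∈is ; l′ , eq′ = old l in l′ , trans eq′ eq }) ,
        named′
      where
      named′ : ∀ j → ∃[ l ] (l ∈ i ∷ is × lookup ys j ≡ η l)
      named′ j with new j
      ... | inj₁ eq = i , here refl , eq
      ... | inj₂ (j′ , eq) with l , l∈is , eq′ ← named j′ = l , there l∈is , trans eq eq′

-- Finding a satisfying quotient.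

record Quotient {NOM : Set} (φ : MHL NOM) (Admissible : ℕ → Shape → Set) : Set where
  field
    {n}        : ℕ
    shs        : Vec Shape (suc n)
    idx        : NOM → Fin (suc n)
    admissible : AllAdmissible Admissible shs
    -- The first point is exempt: it may be the state of evaluation, which need not carry a nominal.
    named      : ∀ j → ∃[ i ] idx i ≡ suc j
    satisfying : ∃[ s ] Satisfaction.Sat {shs = shs} (Q.pointAt shs ∘ idx) s φ

module _ {NOM : Set} (_≟ᴺ_ : DecidableEquality NOM) where
  open import Data.List.Membership.DecPropositional _≟ᴺ_ using (_∈?_)

  quotient : ∀ F (η : NOM → LinearFrame.W F) w φ → record { frame = F ; η = η } ∋ w ⊨ φ →
    (Admissible : ℕ → Shape → Set) →
    (∀ n {P : Shape → Set} → Unary.Decidable P → Dec (∃[ sh ] (Admissible n sh × P sh))) →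
    (let open Game F (NamedBy (nominals φ) η) in
      ∀ {n} x (xs : Vec (LinearFrame.W F) n) →
        ¬ ¬ (∃[ sh ] (Admissible n sh × GapData (md φ) x xs sh))) →
    Quotient φ Admissible
  quotient F η w φ w⊨φ Admissible search gaps
    with p , w≮p , is≮p ← Points.lowerBound F (NamedBy (nominals φ) η) η w (nominals φ)
    with n , xs , asc , index , named
           ← Points.sortedPoints F (NamedBy (nominals φ) η) η p (nominals φ) is≮p = record
      { shs = proj₁ solution ; idx = idx ; admissible = proj₁ (proj₂ solution)
      ; named = named′ ; satisfying = proj₂ (proj₂ solution) }
    where
    open Game F (NamedBy (nominals φ) η)
    idx : NOM → Fin (suc n)
    idx i with i ∈? nominals φ
    ... | yes i∈φ = proj₁ (index i∈φ)
    -- Nominals outside the formula are sent to the first point, so they create no nominal state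
    -- beyond the listed points.
    ... | no  _   = zero
    lookup-idx : ∀ {i} → i ∈ nominals φ → lookup (p ∷ xs) (idx i) ≡ η i
    lookup-idx {i} i∈φ with i ∈? nominals φ
    ... | yes i∈φ′ = proj₂ (index i∈φ′)
    ... | no  i∉φ  = contradiction i∈φ i∉φ
    named′ : ∀ j → ∃[ i ] idx i ≡ suc j
    named′ j with i , i∈φ , eq ← named j =
      i , Asc-injective asc (idx i) (suc j) (trans (lookup-idx i∈φ) (sym eq))
    Satisfying : Vec Shape (suc n) → Set
    Satisfying shs = ∃[ s ] Satisfaction.Sat {shs = shs} (Q.pointAt shs ∘ idx) s φ
    Satisfying? : Unary.Decidable Satisfying
    Satisfying? shs = searchChain shs (λ s → Satisfaction.Sat? (Q.pointAt shs ∘ idx) s φ)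
    solution : ∃[ shs ] (AllAdmissible Admissible shs × Satisfying shs)
    -- The classical reasoning stays under a double negation, which the decidable search removes.
    solution = decidable-stable (searchShapes Admissible search (suc n) Satisfying?)
      (match (md φ) Admissible gaps (p ∷ xs) asc (λ { _ (i , i∈φ , refl) _ → index i∈φ }) >>=
        λ (shs , adm , matched) → Matched.to matched w w≮p >>= λ (s , z) →
        return (shs , adm , s , Transfer.Z⇒Sat F η (nominals φ) asc matched idx lookup-idx
                                  φ id (md φ) ℕₚ.≤-refl ℕₚ.≤-refl z w⊨φ))

-- A gap followed by a further point is not the last one, so its parameter is a successor. Over ℕ
-- this rules out the infinite final gap.
AllAdmissible-lookup : ∀ {Admissible n} {shs : Vec Shape n} → AllAdmissible Admissible shs →
  ∀ {i j : Fin n} → toℕ j ≡ suc (toℕ i) → ∃[ l ] Admissible (suc l) (lookup shs i)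
AllAdmissible-lookup {shs = sh ∷ sh′ ∷ shs} (adm , _) {zero} _ = _ , adm
AllAdmissible-lookup {shs = sh ∷ []} _ {zero} {zero} ()
AllAdmissible-lookup {shs = sh ∷ shs} (_ , adms) {suc i} {suc j} eq =
  AllAdmissible-lookup adms {i} {j} (ℕₚ.suc-injective eq)

-- Realisation over linear frames.

module LinearRealisation (m : ℕ) where

  Admissible : ℕ → Shape → Set
  Admissible _ (_ , k) = k ≤ m

  search : ∀ n {P : Shape → Set} → Unary.Decidable P → Dec (∃[ sh ] (Admissible n sh × P sh))
  search n P? = map′
    (λ { (inj₁ (k , k≤m , p)) → (false , k) , k≤m , p ; (inj₂ (k , k≤m , p)) → (true , k) , k≤m , p })
    (λ { ((false , k) , k≤m , p) → inj₁ (k , k≤m , p) ; ((true , k) , k≤m , p) → inj₂ (k , k≤m , p) })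
    (searchBounded m (P? ∘ (false ,_)) ⊎-dec searchBounded m (P? ∘ (true ,_)))

  realise : ∀ {NOM : Set} (φ : MHL NOM) → Quotient φ Admissible →
            ∃[ K ] (lin (Model.frame K) × QuasiQuadraticIn K m × K satisfies φ)
  realise φ quot = K , tt , quasiQuadratic named sizes , satisfied φ satisfying
    where
    open Quotient quot
    open Chains ⟨0,1⟩ℚ _<₀₁_
    frame′ : LinearFrame
    frame′ = record
      { W = Chain shs ; _<_ = _≺_ ; nonempty = λ empty → empty (pointAt shs zero)
      ; isStrictTotalOrder = ChainProperties.≺-isStrictTotalOrder <₀₁-isStrictTotalOrder }
    identity : IsOrderIsomorphism _≡_ _≡_ (_≺_ {shs = shs}) _≺_ id
    identity = record
      { isOrderMonomorphism = record
        { isOrderHomomorphism = record { cong = id ; mono = id } ; injective = id ; cancel = id }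
      ; surjective = λ y → y , id }
    open Realise ½₀₁ <₀₁-serial idx frame′ id identity
    size : ∀ {a b} sh → proj₂ sh ≤ m → GapIso a b sh →
           ∃[ k ] (k ≤ m × (ConsistsOf frame′ a b k ⊎ ConsistsOfℚThen frame′ a b k))
    size (false , k) k≤m iso = k , k≤m , inj₁ (Sizes.consistsOf frame′ iso)
    size (true  , k) k≤m iso = k , k≤m , inj₂ (consistsOfℚThen frame′ iso)
    sizes : ∀ {i j : Fin (suc n)} → toℕ j ≡ suc (toℕ i) → ∀ {a b} → GapIso a b (lookup shs i) →
            ∃[ k ] (k ≤ m × (ConsistsOf frame′ a b k ⊎ ConsistsOfℚThen frame′ a b k))
    sizes {i} {j} eq = size (lookup shs i) (proj₂ (AllAdmissible-lookup admissible {i} {j} eq))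

-- Realisation over the natural numbers.

module ℕ-Realisation (m : ℕ) where
  open Chains ℕ ℕ._<_

  -- With `D` equal to ℕ, finite gaps followed by a single block at the end make the whole chain a
  -- copy of ℕ.
  Admissible : ℕ → Shape → Set
  Admissible zero    sh      = sh ≡ (true , 0)
  Admissible (suc _) (q , k) = q ≡ false × k ≤ m

  blockToNat : ∀ q → Block q → ℕ
  blockToNat true d = d

  toNat : ∀ {n} {shs : Vec Shape n} → Chain shs → ℕ
  toNat here = 0
  toNat (gap (inj₁ d)) = suc (blockToNat _ d)
  toNat (gap (inj₂ i)) = suc (toℕ i)
  -- The offset counts the point and the `k` states of its gap.
  toNat (later {sh = q , k} s) = suc (k + toNat s)

  toNat-mono : ∀ {n} {shs : Vec Shape n} → AllAdmissible Admissible shs →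
               ∀ {r s : Chain shs} → r ≺ s → toNat r ℕ.< toNat s
  toNat-mono _ (here≺gap {g = inj₁ _}) = s≤s z≤n
  toNat-mono _ (here≺gap {g = inj₂ _}) = s≤s z≤n
  toNat-mono _ here≺later = s≤s z≤n
  toNat-mono {shs = (true , k) ∷ _} _ (gap≺gap (₁∼₁ d<e)) = s≤s d<e
  toNat-mono {shs = (q , k) ∷ []} (refl , _) (gap≺gap (₁∼₂ {y = ()}))
  toNat-mono {shs = (q , k) ∷ _ ∷ _} ((refl , _) , _) (gap≺gap (₁∼₂ {x = ()}))
  toNat-mono _ (gap≺gap (₂∼₂ i<j)) = s≤s i<j
  toNat-mono {shs = (q , k) ∷ _ ∷ _} ((refl , _) , _) (gap≺later {g = inj₁ ()})
  toNat-mono {shs = (q , k) ∷ _ ∷ _} _ (gap≺later {g = inj₂ i}) =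
    s≤s (ℕₚ.<-≤-trans (Finₚ.toℕ<n i) (ℕₚ.m≤m+n k _))
  toNat-mono {shs = (q , k) ∷ _} (_ , adms) (later≺later r≺s) =
    s≤s (ℕₚ.+-monoʳ-< k (toNat-mono adms r≺s))

  toNat-surjective : ∀ {n} {shs : Vec Shape (suc n)} → AllAdmissible Admissible shs →
                     ∀ y → ∃[ s ] toNat {shs = shs} s ≡ y
  toNat-surjective {shs = _ ∷ _} _ zero = here , refl
  toNat-surjective {shs = _ ∷ []} (refl , _) (suc y) = gap (inj₁ y) , refl
  toNat-surjective {shs = (q , k) ∷ _ ∷ _} (_ , adms) (suc y) with y ℕₚ.<? k
  ... | yes y<k = gap (inj₂ (fromℕ< y<k)) , cong suc (Finₚ.toℕ-fromℕ< y<k)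
  ... | no  y≮k with s , eq ← toNat-surjective adms (y ℕ.∸ k) =
          later s , cong suc (trans (cong (k +_) eq) (ℕₚ.m+[n∸m]≡n (ℕₚ.≮⇒≥ y≮k)))

  toNat-isOrderIsomorphism : ∀ {n} {shs : Vec Shape (suc n)} → AllAdmissible Admissible shs →
                             IsOrderIsomorphism _≡_ _≡_ (_≺_ {shs = shs}) ℕ._<_ toNat
  toNat-isOrderIsomorphism {shs = shs} adms = record
    { isOrderMonomorphism = record
      { isOrderHomomorphism = record { cong = cong toNat ; mono = toNat-mono adms }
      ; injective = injective ; cancel = cancel }
    ; surjective = λ y → let s , eq = toNat-surjective adms y in s , λ { refl → eq } }
    where
    open ChainProperties ℕₚ.<-isStrictTotalOrder using (≺-compare)
    injective : ∀ {r s : Chain shs} → toNat r ≡ toNat s → r ≡ s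
    injective {r} {s} eq with ≺-compare r s
    ... | tri< r≺s _ _ = contradiction eq (ℕₚ.<⇒≢ (toNat-mono adms r≺s))
    ... | tri≈ _ r≡s _ = r≡s
    ... | tri> _ _ s≺r = contradiction (sym eq) (ℕₚ.<⇒≢ (toNat-mono adms s≺r))
    cancel : ∀ {r s : Chain shs} → toNat r ℕ.< toNat s → r ≺ s
    cancel {r} {s} r<s with ≺-compare r s
    ... | tri< r≺s _ _ = r≺s
    ... | tri≈ _ refl _ = contradiction r<s (ℕₚ.<-irrefl refl)
    ... | tri> _ _ s≺r = contradiction r<s (ℕₚ.<-asym (toNat-mono adms s≺r))

  search : ∀ n {P : Shape → Set} → Unary.Decidable P → Dec (∃[ sh ] (Admissible n sh × P sh))
  search zero P? = map′ (λ p → _ , refl , p) (λ { (_ , refl , p) → p }) (P? (true , 0))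
  search (suc n) P? = map′
    (λ (k , k≤m , p) → (false , k) , (refl , k≤m) , p) (λ { (_ , (refl , k≤m) , p) → _ , k≤m , p })
    (searchBounded m (P? ∘ (false ,_)))

  module _ (Nom : ℕ → Set) where
    open Game ℕ-frame Nom

    -- All states after the last point go to the block, since ℕ has no greatest element. A gap with
    -- an upper end is explored, and boundedness excludes a block there.
    gaps : ∀ {n} x (xs : Vec ℕ n) → ¬ ¬ (∃[ sh ] (Admissible n sh × GapData m x xs sh))
    gaps x [] = return (_ , refl , record
      { t = λ () ; t-above = λ () ; t-below = λ () ; t-mono = λ { {()} }
      ; cover = λ _ _ _ → inj₂ λ ()
      ; rest = inj₂ (inj₂ (tt , return (suc x , ℕₚ.≤-refl , tt , λ ()) ,
          λ v (x<v , _) → return (suc v , ℕₚ.≤-refl , ℕₚ.m≤n⇒m≤1+n x<v , tt , λ ()))) })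
    gaps x (b ∷ xs) = explore m x (b ∷ xs) >>= λ (sh , k≤m , gd) →
      return (sh , (not-dense sh gd , k≤m) , gd)
      where
      not-dense : ∀ sh → GapData m x (b ∷ xs) sh → proj₁ sh ≡ false
      not-dense (false , k) gd = refl
      not-dense (true  , k) gd with GapData.rest gd
      ... | inj₁ (¬d , _) = contradiction tt ¬d
      ... | inj₂ (inj₁ (¬d , _)) = contradiction tt ¬d
      ... | inj₂ (inj₂ (_ , inhabited , unbounded)) =
              ⊥-elim (inhabited λ (v , v-rest) → climb b v v-rest (ℕₚ.m≤m+n b v))
        where
        -- `fuel` bounds the distance from `v` to `b`. It shrinks with each step up, yet every state
        -- reached lies below `b`.
        climb : ∀ fuel v → GapData.Rest gd v → b ≤ fuel + v → ⊥
        climb zero    v (_ , v<b , _) b≤v = ℕₚ.<⇒≱ v<b b≤v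
        climb (suc f) v v-rest        b≤  = unbounded v v-rest λ (u , v<u , u-rest) →
          climb f u u-rest (ℕₚ.≤-trans (subst (b ≤_) (sym (ℕₚ.+-suc f v)) b≤) (ℕₚ.+-monoʳ-≤ f v<u))

  realise : ∀ {NOM : Set} (φ : MHL NOM) → Quotient φ Admissible →
            ∃[ K ] (onlyℕ (Model.frame K) × QuasiQuadraticIn K m × K satisfies φ)
  realise φ quot = K , refl , quasiQuadratic named sizes , satisfied φ satisfying
    where
    open Quotient quot
    suc-serial : ∀ d → ∃[ e ] d ℕ.< e
    suc-serial d = suc d , ℕₚ.≤-refl
    -- The class contains only `ℕ-frame` itself, so the model lives there and `toNat` carries the
    -- chain over.
    open Realise 0 suc-serial idx ℕ-frame toNat (toNat-isOrderIsomorphism admissible)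
    size : ∀ {a b} l sh → Admissible (suc l) sh → GapIso a b sh →
           ∃[ k ] (k ≤ m × (ConsistsOf ℕ-frame a b k ⊎ ConsistsOfℚThen ℕ-frame a b k))
    size _ (_ , k) (refl , k≤m) iso = k , k≤m , inj₁ (Sizes.consistsOf ℕ-frame iso)
    sizes : ∀ {i j : Fin (suc n)} → toℕ j ≡ suc (toℕ i) → ∀ {a b} → GapIso a b (lookup shs i) →
            ∃[ k ] (k ≤ m × (ConsistsOf ℕ-frame a b k ⊎ ConsistsOfℚThen ℕ-frame a b k))
    sizes {i} {j} eq =
      let l , adm = AllAdmissible-lookup admissible {i} {j} eq in size l (lookup shs i) adm

-- The two frame classes.

module _ {NOM : Set} (_≟ᴺ_ : DecidableEquality NOM) where

  lin-quasiQuadratic : QuasiQuadraticSizeModelProperty NOM lin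
  lin-quasiQuadratic φ (record { frame = F ; η = η } , _ , w , w⊨φ) =
    realise φ (quotient _≟ᴺ_ F η w φ w⊨φ Admissible search (Game.explore F _ (md φ)))
    where open LinearRealisation (md φ)

  onlyℕ-quasiQuadratic : QuasiQuadraticSizeModelProperty NOM onlyℕ
  onlyℕ-quasiQuadratic φ (record { frame = F ; η = η } , refl , w , w⊨φ) =
    realise φ (quotient _≟ᴺ_ ℕ-frame η w φ w⊨φ Admissible search (gaps _))
    where open ℕ-Realisation (md φ)

theorem5p4 : (NOM : Set) → NOM ↣ ℕ →
    QuasiQuadraticSizeModelProperty NOM lin × QuasiQuadraticSizeModelProperty NOM onlyℕ
theorem5p4 NOM code = lin-quasiQuadratic _≟ᴺ_ , onlyℕ-quasiQuadratic _≟ᴺ_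
  where
  -- Countability supplies decidable equality of nominals, by which those occurring in the formula
  -- receive their indices.
  _≟ᴺ_ : DecidableEquality NOM
  _≟ᴺ_ = via-injection code ℕₚ._≟_
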